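{- Let $K$ be a nonempty compact Hausdorff space. If $K$ has a regular tunnel of cardinality $\kappa$, then there exists a nontrivial short exact sequence of Banach spaces $$0\longrightarrow C(K)\longrightarrow Z\longrightarrow c_0(\kappa)\longrightarrow 0 .$$
   Context: For open $U,V$ in a Hausdorff space $X$, $U<V$ means $\overline U\subseteq V$, and $U\le V$ means $U<V$ or $U=V$. A chain (of open sets) is a family of open subsets of $X$ linearly ordered by $\le$. A tunnel in $X$ is a chain $\mathscr U$ of open subsets of $X$ such that $\bigcup\{\partial U:U\in\mathscr U\}$ is dense in $X$. An open set is regular if it equals the interior of its closure; a regular tunnel is a tunnel consisting of regular open sets. $C(K)$ is the Banach space of continuous functions $K\to\mathbb R$ with the sup norm. For a set $I$, $c_0(I)$ is the space of functions $f\colon I\to\mathbb R$ such that $\{i\in I:|f(i)|>\varepsilon\}$ is finite for every $\varepsilon>0$, with the sup norm. A short exact sequence $0\to Y\xrightarrow{\imath}Z\xrightarrow{\pi}X\to0$ of Banach spaces is a diagram of Banach spaces and bounded linear operators in which the kernel of each arrow equals the range of the preceding one. It is trivial if there is a bounded linear operator $\varpi\colon Z\to Y$ with $\varpi\circ\imath=\mathrm{Id}_Y$; otherwise it is nontrivial. -}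

module Defs where

open import Algebra.Bundles using (CommutativeRing)
import Algebra.Construct.NaturalChoice.Max as Max
open import Algebra.Module.Bundles using (LeftModule)
open import Algebra.Module.Morphism.Structures using (module LeftModuleMorphisms)
import Algebra.Properties.Ring as RingProperties
open import Axiom.ExcludedMiddle using (ExcludedMiddle)
open import Data.Empty using (⊥-elim)
open import Data.List.Base using (List; []; _∷_; _++_)
import Data.List.Membership.Setoid as ListMembership
open import Data.List.Relation.Unary.Any using (Any; here; there)
open import Data.List.Relation.Unary.Any.Properties using (++⁺ˡ; ++⁺ʳ)
open import Data.Nat.Base as ℕ using (ℕ)
import Data.Nat.Properties as ℕ
open import Data.Product.Base using (Σ; ∃; _×_; _,_; proj₁; proj₂)
open import Data.Sum.Base using (_⊎_; inj₁; inj₂)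
open import Data.Unit.Polymorphic.Base using (⊤; tt)
open import Function.Base using (_on_)
open import Function.Bundles using (Func; Bijection)
open import Level using (Level; 0ℓ; _⊔_; suc)
open import Relation.Binary.Bundles using (Setoid; TotalOrder)
open import Relation.Binary.Core using (Rel)
open import Relation.Binary.Definitions using (_Respects_)
open import Relation.Binary.Structures using (IsTotalOrder)
import Relation.Binary.Construct.On as On
import Relation.Binary.Construct.NonStrictToStrict as NonStrictToStrict
import Relation.Binary.Reasoning.Setoid as ≈-Reasoning
open import Relation.Nullary using (¬_; Dec; yes; no)
open import Relation.Nullary.Decidable using (True; toWitness; fromWitness)
open import Relation.Unary
  using (Pred; _∈_; _⊆_; _≐_; _∩_; ∁; ⋃; _≬_; _⊥_; Universal; U)
open import Relation.Unary.Relation.Binary.Equality using (≐-setoid)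

private
  variable
    ℓ u i e p m₁ m₂ m₃ e₁ e₂ e₃ : Level

-- Dedekind-complete ordered fields are classically unique up to isomorphism, so ℝ is an
-- arbitrary one.  Equality is a setoid equality, as Agda has no quotients.
record CompleteOrderedField : Set₁ where
  field
    commutativeRing : CommutativeRing 0ℓ 0ℓ

  open CommutativeRing commutativeRing public

  infix 4 _≤_ _<_

  field
    _≤_          : Rel Carrier 0ℓ
    isTotalOrder : IsTotalOrder _≈_ _≤_
    0≉1          : ¬ (0# ≈ 1#)
    inverse      : ∀ x → ¬ (x ≈ 0#) → ∃ λ y → x * y ≈ 1#
    +-monoˡ-≤    : ∀ z {x y} → x ≤ y → x + z ≤ y + z
    *-nonneg     : ∀ {x y} → 0# ≤ x → 0# ≤ y → 0# ≤ x * y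

  UpperBound : Pred Carrier p → Carrier → Set p
  UpperBound P b = ∀ x → x ∈ P → x ≤ b

  IsSupremum : Pred Carrier p → Carrier → Set p
  IsSupremum P s = UpperBound P s × (∀ b → UpperBound P b → s ≤ b)

  field
    supremum : (P : Pred Carrier 0ℓ) → ∃ P → ∃ (UpperBound P) → ∃ (IsSupremum P)

  _<_ : Rel Carrier 0ℓ
  _<_ = NonStrictToStrict._<_ _≈_ _≤_

  totalOrder : TotalOrder 0ℓ 0ℓ 0ℓ
  totalOrder = record { isTotalOrder = isTotalOrder }

  ∣_∣ : Carrier → Carrier
  ∣ x ∣ = Max._⊔_ totalOrder x (- x)

record TopologicalSpace ℓ : Set (suc (suc ℓ)) where
  field
    points : Setoid ℓ ℓ

  open Setoid points public using () renaming (Carrier to Point; _≈_ to _≈ₚ_)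

  field
    IsOpen        : Pred (Pred Point ℓ) ℓ
    open-resp-≈   : ∀ {V} → IsOpen V → V Respects _≈ₚ_
    open-resp-≐   : ∀ {V W} → V ≐ W → IsOpen V → IsOpen W
    open-whole    : ∀ {V} → Universal V → IsOpen V
    open-∩        : ∀ {V W} → IsOpen V → IsOpen W → IsOpen (V ∩ W)
    open-⋃        : (J : Set ℓ) (V : J → Pred Point ℓ) →
                    (∀ j → IsOpen (V j)) → IsOpen (⋃ J V)

module _ (K : TopologicalSpace ℓ) where

  open TopologicalSpace K

  Nonempty : Set ℓ
  Nonempty = Point

  Hausdorff : Set (suc ℓ)
  Hausdorff = ∀ x y → ¬ (x ≈ₚ y) →
    ∃ λ V → ∃ λ W → IsOpen V × IsOpen W × x ∈ V × y ∈ W × V ⊥ W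

  Compact : Set (suc ℓ)
  Compact = (J : Set ℓ) (V : J → Pred Point ℓ) → (∀ j → IsOpen (V j)) →
    Universal (⋃ J V) → ∃ λ (js : List J) → ∀ x → Any (λ j → x ∈ V j) js

  closure : Pred Point p → Pred Point (suc ℓ ⊔ p)
  closure A x = ∀ V → IsOpen V → x ∈ V → V ≬ A

  interior : Pred Point p → Pred Point (suc ℓ ⊔ p)
  interior A x = ∃ λ V → IsOpen V × x ∈ V × V ⊆ A

  ∂ : Pred Point p → Pred Point (suc ℓ ⊔ p)
  ∂ A = closure A ∩ closure (∁ A)

  Dense : Pred Point p → Set (suc ℓ ⊔ p)
  Dense A = Universal (closure A)

  -- V ⋖ W and V ⊴ W are the V < W and V ≤ W of the tunnel literature.
  infix 4 _⋖_ _⊴_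

  _⋖_ : Rel (Pred Point ℓ) (suc ℓ)
  V ⋖ W = closure V ⊆ W

  _⊴_ : Rel (Pred Point ℓ) (suc ℓ)
  V ⊴ W = V ⋖ W ⊎ V ≐ W

  IsRegular : Pred Point ℓ → Set (suc ℓ)
  IsRegular V = V ≐ interior (closure V)

  -- A family 𝒰 of subsets, as a setoid whose equality is equality of subsets.
  Members : Pred (Pred Point ℓ) u → Setoid (suc ℓ ⊔ u) ℓ
  Members 𝒰 = On.setoid {B = Σ (Pred Point ℓ) 𝒰} (≐-setoid Point ℓ) proj₁

  record IsChain (𝒰 : Pred (Pred Point ℓ) u) : Set (suc ℓ ⊔ u) where
    field
      isOpen          : 𝒰 ⊆ IsOpen
      linearlyOrdered : IsTotalOrder (Setoid._≈_ (Members 𝒰)) (_⊴_ on proj₁)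

  record IsTunnel (𝒰 : Pred (Pred Point ℓ) u) : Set (suc ℓ ⊔ u) where
    field
      isChain : IsChain 𝒰
      dense   : Dense (⋃ (Σ (Pred Point ℓ) 𝒰) (λ V → ∂ (proj₁ V)))

  record IsRegularTunnel (𝒰 : Pred (Pred Point ℓ) u) : Set (suc ℓ ⊔ u) where
    field
      isTunnel : IsTunnel 𝒰
      regular  : 𝒰 ⊆ IsRegular

  -- A cardinal is represented by any set (setoid) κ having that cardinality.
  HasCardinality : Pred (Pred Point ℓ) u → Setoid i e → Set (suc ℓ ⊔ u ⊔ i ⊔ e)
  HasCardinality 𝒰 κ = Bijection κ (Members 𝒰)

module _ (ℝ : CompleteOrderedField) where

  private module ℝ = CompleteOrderedField ℝ

  record NormedSpace m e : Set (suc (m ⊔ e)) where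
    field
      vectorSpace : LeftModule ℝ.ring m e

    open LeftModule vectorSpace public

    field
      ‖_‖           : Carrierᴹ → ℝ.Carrier
      ‖‖-cong       : ∀ {x y} → x ≈ᴹ y → ‖ x ‖ ℝ.≈ ‖ y ‖
      ‖‖-nonneg     : ∀ x → ℝ.0# ℝ.≤ ‖ x ‖
      ‖‖-definite   : ∀ x → ‖ x ‖ ℝ.≈ ℝ.0# → x ≈ᴹ 0ᴹ
      ‖‖-homo       : ∀ a x → ‖ a *ₗ x ‖ ℝ.≈ ℝ.∣ a ∣ ℝ.* ‖ x ‖
      ‖‖-triangle   : ∀ x y → ‖ x +ᴹ y ‖ ℝ.≤ ‖ x ‖ ℝ.+ ‖ y ‖

    Cauchy : (ℕ → Carrierᴹ) → Set
    Cauchy x = ∀ ε → ℝ.0# ℝ.< ε →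
      ∃ λ N → ∀ j k → N ℕ.≤ j → N ℕ.≤ k → ‖ x j +ᴹ -ᴹ (x k) ‖ ℝ.< ε

    ConvergesTo : (ℕ → Carrierᴹ) → Carrierᴹ → Set
    ConvergesTo x l = ∀ ε → ℝ.0# ℝ.< ε →
      ∃ λ N → ∀ k → N ℕ.≤ k → ‖ x k +ᴹ -ᴹ l ‖ ℝ.< ε

  record BanachSpace m e : Set (suc (m ⊔ e)) where
    field
      normedSpace : NormedSpace m e

    open NormedSpace normedSpace public

    field
      complete : ∀ x → Cauchy x → ∃ (ConvergesTo x)

  record BoundedOperator (X : BanachSpace m₁ e₁) (Y : BanachSpace m₂ e₂)
         : Set (m₁ ⊔ e₁ ⊔ m₂ ⊔ e₂) where
    private
      module X = BanachSpace X
      module Y = BanachSpace Y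
    open LeftModuleMorphisms X.rawLeftModule Y.rawLeftModule
      using (IsLeftModuleHomomorphism)
    field
      ⟦_⟧      : X.Carrierᴹ → Y.Carrierᴹ
      isLinear : IsLeftModuleHomomorphism ⟦_⟧
      bounded  : ∃ λ C → ∀ x → Y.‖ ⟦ x ⟧ ‖ ℝ.≤ C ℝ.* X.‖ x ‖

    Kernel : Pred X.Carrierᴹ e₂
    Kernel x = ⟦ x ⟧ Y.≈ᴹ Y.0ᴹ

    Range : Pred Y.Carrierᴹ (m₁ ⊔ e₂)
    Range y = ∃ λ x → ⟦ x ⟧ Y.≈ᴹ y

  record ShortExactSequence
         (Y : BanachSpace m₁ e₁) (Z : BanachSpace m₂ e₂) (X : BanachSpace m₃ e₃)
         : Set (m₁ ⊔ e₁ ⊔ m₂ ⊔ e₂ ⊔ m₃ ⊔ e₃) where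
    private
      module Y = BanachSpace Y
    open BoundedOperator using (⟦_⟧; Kernel; Range)
    field
      ι       : BoundedOperator Y Z
      π       : BoundedOperator Z X
      -- {0} is the range of 0 → Y, and U (all of X) is the kernel of X → 0.
      exact-Y : Kernel ι ≐ (Y._≈ᴹ Y.0ᴹ)
      exact-Z : Kernel π ≐ Range ι
      exact-X : U ≐ Range π

    Trivial : Set (m₁ ⊔ e₁ ⊔ m₂ ⊔ e₂)
    Trivial = ∃ λ (ϖ : BoundedOperator Z Y) → ∀ y → ⟦ ϖ ⟧ (⟦ ι ⟧ y) Y.≈ᴹ y

    Nontrivial : Set (m₁ ⊔ e₁ ⊔ m₂ ⊔ e₂)
    Nontrivial = ¬ Trivial

module Real (ℝ : CompleteOrderedField) where

  open CompleteOrderedField ℝ public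
  open RingProperties ring public
    using (-‿distribˡ-*; -‿distribʳ-*; -‿involutive; -0#≈0#; -‿+-comm)
  open Max totalOrder public using () renaming (_⊔_ to _∨_)

  module O = IsTotalOrder isTotalOrder
  module S = NonStrictToStrict _≈_ _≤_
  open import Algebra.Properties.CommutativeSemigroup +-commutativeSemigroup
    public using (interchange)

  private
    module M = Max totalOrder

  ≤-refl : ∀ {x} → x ≤ x
  ≤-refl = O.refl

  ≤-trans : ∀ {x y z} → x ≤ y → y ≤ z → x ≤ z
  ≤-trans = O.trans

  ≈⇒≤ : ∀ {x y} → x ≈ y → x ≤ y
  ≈⇒≤ = O.reflexive

  ≤-resp : ∀ {x x′ y y′} → x ≈ x′ → y ≈ y′ → x ≤ y → x′ ≤ y′
  ≤-resp p q r = ≤-trans (≈⇒≤ (sym p)) (≤-trans r (≈⇒≤ q))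

  +-mono-≤ : ∀ {x y z w} → x ≤ y → z ≤ w → x + z ≤ y + w
  +-mono-≤ {x} {y} {z} {w} p q = ≤-trans (+-monoˡ-≤ z p)
    (≤-resp (+-comm z y) (+-comm w y) (+-monoˡ-≤ y q))

  <-≤-trans : ∀ {x y z} → x < y → y ≤ z → x < z
  <-≤-trans = S.<-≤-trans sym O.trans O.antisym O.≤-respʳ-≈

  ≤-<-trans : ∀ {x y z} → x ≤ y → y < z → x < z
  ≤-<-trans = S.≤-<-trans O.trans O.antisym O.≤-respˡ-≈

  ≰⇒> : ∀ {x y} → ¬ (x ≤ y) → y < x
  ≰⇒> = S.≰⇒> sym O.reflexive O.total

  <⇒≱ : ∀ {x y} → x < y → ¬ (y ≤ x)
  <⇒≱ = S.<⇒≱ O.antisym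

  x+y-y : ∀ x y → (x + y) + - y ≈ x
  x+y-y x y = trans (+-assoc x y (- y))
    (trans (+-congˡ (-‿inverseʳ y)) (+-identityʳ x))

  x-y+y : ∀ x y → (x + - y) + y ≈ x
  x-y+y x y = trans (+-assoc x (- y) y)
    (trans (+-congˡ (-‿inverseˡ y)) (+-identityʳ x))

  +-cancelʳ-≤ : ∀ {x y} z → x + z ≤ y + z → x ≤ y
  +-cancelʳ-≤ {x} {y} z p = ≤-resp (x+y-y x z) (x+y-y y z) (+-monoˡ-≤ (- z) p)

  x-y≤z⇒x≤z+y : ∀ {x y z} → x + - y ≤ z → x ≤ z + y
  x-y≤z⇒x≤z+y {x} {y} p = ≤-resp (x-y+y x y) refl (+-monoˡ-≤ y p)

  x≤z+y⇒x-y≤z : ∀ {x y z} → x ≤ z + y → x + - y ≤ z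
  x≤z+y⇒x-y≤z {x} {y} {z} p = ≤-resp refl (x+y-y z y) (+-monoˡ-≤ (- y) p)

  neg-sub : ∀ x y → - (x + - y) ≈ y + - x
  neg-sub x y = trans (sym (-‿+-comm x (- y)))
    (trans (+-congˡ (-‿involutive y)) (+-comm (- x) y))

  neg-mono : ∀ {x y} → x ≤ y → - y ≤ - x
  neg-mono {x} {y} p = ≤-resp
    (trans (sym (+-assoc x (- x) (- y)))
      (trans (+-congʳ (-‿inverseʳ x)) (+-identityˡ (- y))))
    (trans (+-congˡ (+-comm (- x) (- y)))
      (trans (sym (+-assoc y (- y) (- x)))
        (trans (+-congʳ (-‿inverseʳ y)) (+-identityˡ (- x)))))
    (+-monoˡ-≤ (- x + - y) p)

  0≤1 : 0# ≤ 1#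
  0≤1 with O.total 0# 1#
  ... | inj₁ q = q
  ... | inj₂ q = ≤-resp refl
    (trans (sym (-‿distribˡ-* 1# (- 1#)))
      (trans (-‿cong (*-identityˡ (- 1#))) (-‿involutive 1#)))
    (*-nonneg 0≤-1 0≤-1)
    where
    0≤-1 : 0# ≤ - 1#
    0≤-1 = ≤-resp -0#≈0# refl (neg-mono q)

  0<1 : 0# < 1#
  0<1 = 0≤1 , 0≉1

  x≤x+nonneg : ∀ {x y} → 0# ≤ y → x ≤ x + y
  x≤x+nonneg {x} {y} q = ≤-resp (+-identityʳ x) refl (+-mono-≤ (≤-refl {x}) q)

  *-monoˡ-≤ : ∀ {a x y} → 0# ≤ a → x ≤ y → a * x ≤ a * y
  *-monoˡ-≤ {a} {x} {y} 0≤a x≤y = ≤-resp (+-identityˡ (a * x))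
    (trans (+-congʳ (trans (distribˡ a y (- x))
             (+-congˡ (sym (-‿distribʳ-* a x)))))
      (x-y+y (a * y) (a * x)))
    (+-monoˡ-≤ (a * x) (*-nonneg 0≤a
      (≤-resp (-‿inverseʳ x) refl (+-monoˡ-≤ (- x) x≤y))))

  0<2 : 0# < 1# + 1#
  0<2 = <-≤-trans 0<1 (x≤x+nonneg 0≤1)

  half : ∀ {ε} → 0# < ε → ∃ λ δ → 0# < δ × δ + δ ≈ ε
  half {ε} 0<ε = δ , (0≤δ , 0≉δ) , δ+δ≈ε
    where
    h : ∃ λ y → (1# + 1#) * y ≈ 1#
    h = inverse (1# + 1#) (λ q → proj₂ 0<2 (sym q))
    δ : Carrier
    δ = proj₁ h * ε
    δ+δ≈ε : δ + δ ≈ ε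
    δ+δ≈ε = begin
      δ + δ               ≈⟨ +-cong (*-identityˡ δ) (*-identityˡ δ) ⟨
      1# * δ + 1# * δ     ≈⟨ distribʳ δ 1# 1# ⟨
      (1# + 1#) * δ       ≈⟨ *-assoc (1# + 1#) (proj₁ h) ε ⟨
      (1# + 1#) * proj₁ h * ε ≈⟨ *-congʳ (proj₂ h) ⟩
      1# * ε              ≈⟨ *-identityˡ ε ⟩
      ε                   ∎
      where open ≈-Reasoning setoid
    0≉δ : ¬ (0# ≈ δ)
    0≉δ q = proj₂ 0<ε (trans (sym (+-identityˡ 0#)) (trans (+-cong q q) δ+δ≈ε))
    0≤δ : 0# ≤ δ
    0≤δ with O.total 0# δ
    ... | inj₁ q = q
    ... | inj₂ q = ⊥-elim (<⇒≱ 0<ε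
      (≤-resp δ+δ≈ε (+-identityˡ 0#) (+-mono-≤ q q)))

  ∣∣-cong : ∀ {x y} → x ≈ y → ∣ x ∣ ≈ ∣ y ∣
  ∣∣-cong q = M.⊔-cong q (-‿cong q)

  x≤∣x∣ : ∀ x → x ≤ ∣ x ∣
  x≤∣x∣ x = M.x≤x⊔y x (- x)

  -x≤∣x∣ : ∀ x → - x ≤ ∣ x ∣
  -x≤∣x∣ x = M.x≤y⊔x x (- x)

  ∣∣-lub : ∀ {x c} → x ≤ c → - x ≤ c → ∣ x ∣ ≤ c
  ∣∣-lub = M.⊔-lub

  ∣∣-nonneg : ∀ x → 0# ≤ ∣ x ∣
  ∣∣-nonneg x with O.total 0# x
  ... | inj₁ q = ≤-trans q (x≤∣x∣ x)
  ... | inj₂ q = ≤-trans (≤-resp -0#≈0# refl (neg-mono q)) (-x≤∣x∣ x)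

  nonneg⇒∣∣ : ∀ {x} → 0# ≤ x → ∣ x ∣ ≈ x
  nonneg⇒∣∣ {x} q = O.antisym
    (∣∣-lub ≤-refl (≤-trans (≤-resp refl -0#≈0# (neg-mono q)) q)) (x≤∣x∣ x)

  ∣-x∣ : ∀ x → ∣ - x ∣ ≈ ∣ x ∣
  ∣-x∣ x = O.antisym
    (∣∣-lub (-x≤∣x∣ x) (≤-resp (sym (-‿involutive x)) refl (x≤∣x∣ x)))
    (∣∣-lub (≤-resp (-‿involutive x) refl (-x≤∣x∣ (- x))) (x≤∣x∣ (- x)))

  nonpos⇒∣∣ : ∀ {x} → x ≤ 0# → ∣ x ∣ ≈ - x
  nonpos⇒∣∣ {x} q = trans (sym (∣-x∣ x))
    (nonneg⇒∣∣ (≤-resp -0#≈0# refl (neg-mono q)))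

  ∣∣-triangle : ∀ x y → ∣ x + y ∣ ≤ ∣ x ∣ + ∣ y ∣
  ∣∣-triangle x y = ∣∣-lub (+-mono-≤ (x≤∣x∣ x) (x≤∣x∣ y))
    (≤-resp (-‿+-comm x y) refl (+-mono-≤ (-x≤∣x∣ x) (-x≤∣x∣ y)))

  ∣∣-definite : ∀ x → ∣ x ∣ ≤ 0# → x ≈ 0#
  ∣∣-definite x q = O.antisym (≤-trans (x≤∣x∣ x) q)
    (≤-resp -0#≈0# (-‿involutive x) (neg-mono (≤-trans (-x≤∣x∣ x) q)))

  ∣0∣ : ∣ 0# ∣ ≈ 0#
  ∣0∣ = nonneg⇒∣∣ ≤-refl

  ∣sub∣-comm : ∀ x y → ∣ x + - y ∣ ≈ ∣ y + - x ∣
  ∣sub∣-comm x y = trans (sym (∣-x∣ (x + - y))) (∣∣-cong (neg-sub x y))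

  ∣sub∣-trans : ∀ x y z → ∣ x + - z ∣ ≤ ∣ x + - y ∣ + ∣ y + - z ∣
  ∣sub∣-trans x y z = ≤-resp (∣∣-cong lem) refl (∣∣-triangle (x + - y) (y + - z))
    where
    lem : (x + - y) + (y + - z) ≈ x + - z
    lem = trans (sym (+-assoc (x + - y) y (- z))) (+-congʳ (x-y+y x y))

  ∣∣-* : ∀ x y → ∣ x * y ∣ ≈ ∣ x ∣ * ∣ y ∣
  ∣∣-* x y = trans (lem x y) (*-congˡ refl)
    where
    nn : ∀ x y → 0# ≤ x → ∣ x * y ∣ ≈ ∣ x ∣ * ∣ y ∣
    nn x y 0≤x with O.total 0# y
    ... | inj₁ q = trans (nonneg⇒∣∣ (*-nonneg 0≤x q))
      (sym (*-cong (nonneg⇒∣∣ 0≤x) (nonneg⇒∣∣ q)))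
    ... | inj₂ q = trans (nonpos⇒∣∣ (≤-resp refl (zeroʳ x) (*-monoˡ-≤ 0≤x q)))
      (trans (-‿distribʳ-* x y)
        (sym (*-cong (nonneg⇒∣∣ 0≤x) (nonpos⇒∣∣ q))))
    lem : ∀ x y → ∣ x * y ∣ ≈ ∣ x ∣ * ∣ y ∣
    lem x y with O.total 0# x
    ... | inj₁ q = nn x y q
    ... | inj₂ q = trans (sym (∣-x∣ (x * y)))
      (trans (∣∣-cong (-‿distribˡ-* x y))
        (trans (nn (- x) y (≤-resp -0#≈0# refl (neg-mono q))) (*-congʳ (∣-x∣ x))))

  x≤x∨y : ∀ x y → x ≤ x ∨ y
  x≤x∨y = M.x≤x⊔y

  y≤x∨y : ∀ x y → y ≤ x ∨ y
  y≤x∨y = M.x≤y⊔x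

  +-monoˡ-< : ∀ z {x y} → x < y → x + z < y + z
  +-monoˡ-< z p = +-monoˡ-≤ z (proj₁ p)
    , λ q → proj₂ p (trans (sym (x+y-y _ z)) (trans (+-congʳ q) (x+y-y _ z)))

  +-monoʳ-< : ∀ z {x y} → x < y → z + x < z + y
  +-monoʳ-< z {x} {y} p = ≤-<-trans (≈⇒≤ (+-comm z x))
    (<-≤-trans (+-monoˡ-< z p) (≈⇒≤ (+-comm y z)))

  +-mono-< : ∀ {x y z w} → x < y → z < w → x + z < y + w
  +-mono-< {y = y} {z = z} p q = <-≤-trans (+-monoˡ-< z p) (proj₁ (+-monoʳ-< y q))

  half<whole : ∀ {δ ε} → 0# < δ → δ + δ ≈ ε → δ < ε
  half<whole {δ} 0<δ q = ≤-<-trans (≈⇒≤ (sym (+-identityˡ δ)))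
    (<-≤-trans (+-monoˡ-< δ 0<δ) (≈⇒≤ q))

  ∣x∣≤∣x-y∣+∣y∣ : ∀ {x y z} → ∣ x + - y ∣ ≤ z → ∣ x ∣ ≤ z + ∣ y ∣
  ∣x∣≤∣x-y∣+∣y∣ {x} {y} p = ≤-trans
    (≤-resp (∣∣-cong (x-y+y x y)) refl (∣∣-triangle (x + - y) y)) (+-monoˡ-≤ ∣ y ∣ p)

  sub-add : ∀ x y z w → (x + - y) + (z + - w) ≈ (x + z) + - (y + w)
  sub-add x y z w = trans (interchange x (- y) z (- w)) (+-congˡ (-‿+-comm y w))

  sub-scale : ∀ a x y → a * x + - (a * y) ≈ a * (x + - y)
  sub-scale a x y = trans (+-congˡ (-‿distribʳ-* a y)) (sym (distribˡ a x (- y)))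

  rearrange : ∀ η δ → η + (δ + η) ≈ (η + η) + δ
  rearrange η δ = trans (+-congˡ (+-comm δ η)) (sym (+-assoc η η δ))

  positive-inverse : ∀ {b} → 0# < b → ∃ λ c → 0# < c × b * c ≈ 1#
  positive-inverse {b} 0<b with inverse b (λ q → proj₂ 0<b (sym q))
  ... | c , bc≈1 with O.total 0# c
  ...   | inj₁ 0≤c = c , (0≤c , λ q → 0≉1
            (trans (sym (zeroʳ b)) (trans (*-congˡ q) bc≈1))) , bc≈1
  ...   | inj₂ c≤0 = ⊥-elim (<⇒≱ 0<1
            (≤-resp bc≈1 (zeroʳ b) (*-monoˡ-≤ (proj₁ 0<b) c≤0)))

  scaled : ∀ a {ε} → 0# < ε → ∃ λ δ → 0# < δ × ∣ a ∣ * δ < ε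
  scaled a {ε} 0<ε with positive-inverse
    (<-≤-trans 0<1 (≤-resp refl (+-comm 1# ∣ a ∣) (x≤x+nonneg (∣∣-nonneg a))))
  ... | c , 0<c , bc≈1 = c * ε , 0<δ , ∣a∣δ<ε
    where
    bδ≈ε : (∣ a ∣ + 1#) * (c * ε) ≈ ε
    bδ≈ε = trans (sym (*-assoc _ c ε)) (trans (*-congʳ bc≈1) (*-identityˡ ε))
    0<δ : 0# < c * ε
    0<δ = *-nonneg (proj₁ 0<c) (proj₁ 0<ε) , λ q → proj₂ 0<ε
      (trans (sym (zeroʳ (∣ a ∣ + 1#))) (trans (*-congˡ q) bδ≈ε))
    ∣a∣δ<ε : ∣ a ∣ * (c * ε) < ε
    ∣a∣δ<ε = ≤-<-trans (≈⇒≤ (sym (+-identityʳ _)))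
      (<-≤-trans (+-monoʳ-< (∣ a ∣ * (c * ε)) 0<δ)
        (≈⇒≤ (trans (+-congˡ (sym (*-identityˡ (c * ε))))
          (trans (sym (distribʳ (c * ε) ∣ a ∣ 1#)) bδ≈ε))))

-- The ambient classical logic is the explicit hypothesis em; since it decides
-- Σ-types too, it also yields choice.  It is what makes suprema available for
-- predicates at every level.
module SupNorm (em : ∀ {a} → ExcludedMiddle a) (ℝ : CompleteOrderedField) where

  open Real ℝ

  sup : (P : Pred Carrier p) → ∃ P → ∃ (UpperBound P) → ∃ (IsSupremum P)
  sup P (x , x∈P) (b , ub) =
    let s , upper , least = supremum (λ r → True (em {P = P r}))
          (x , fromWitness x∈P) (b , λ r r∈P → ub r (toWitness r∈P))
    in s , (λ r r∈P → upper r (fromWitness r∈P))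
         , (λ c c-ub → least c (λ r r∈P → c-ub r (toWitness r∈P)))

  ≤+ε⇒≤ : ∀ {x y} → (∀ ε → 0# < ε → x ≤ y + ε) → x ≤ y
  ≤+ε⇒≤ {x} {y} h with em {P = x ≤ y}
  ... | yes q = q
  ... | no x≰y = ⊥-elim (<⇒≱ y<x x≤y)
    where
    y<x : y < x
    y<x = ≰⇒> x≰y
    0<x-y : 0# < x + - y
    0<x-y = ≤-resp (-‿inverseʳ y) refl (+-monoˡ-≤ (- y) (proj₁ y<x))
          , λ q → proj₂ y<x (trans (sym (+-identityˡ y)) (trans (+-congʳ q) (x-y+y x y)))
    x≤y : x ≤ y
    x≤y with half 0<x-y
    ... | δ , 0<δ , δ+δ≈x-y = ⊥-elim (<⇒≱ 0<δ (+-cancelʳ-≤ δ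
      (≤-resp (sym δ+δ≈x-y) (sym (+-identityˡ δ))
        (x≤z+y⇒x-y≤z (≤-resp refl (+-comm y δ) (h δ 0<δ))))))

  -- Cauchy completeness of ℝ; the limit is the supremum of the numbers that
  -- are eventually below the sequence.
  module Limit (a : ℕ → Carrier)
    (cauchy : ∀ ε → 0# < ε →
      ∃ λ N → ∀ j k → N ℕ.≤ j → N ℕ.≤ k → ∣ a j + - a k ∣ ≤ ε)
    where

    Below : Pred Carrier 0ℓ
    Below r = ∃ λ N → ∀ n → N ℕ.≤ n → r ≤ a n

    module _ {ε} (0<ε : 0# < ε) (k : ℕ) (N≤k : proj₁ (cauchy ε 0<ε) ℕ.≤ k) where

      below : Below (a k + - ε)
      below = proj₁ (cauchy ε 0<ε) , λ n N≤n → x≤z+y⇒x-y≤z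
        (≤-resp refl (+-comm ε (a n)) (x-y≤z⇒x≤z+y
          (≤-trans (x≤∣x∣ _) (proj₂ (cauchy ε 0<ε) k n N≤k N≤n))))

      above : UpperBound Below (a k + ε)
      above r (M , r≤) = ≤-trans (r≤ n (ℕ.m≤n⊔m N M))
        (≤-resp refl (+-comm ε (a k)) (x-y≤z⇒x≤z+y
          (≤-trans (x≤∣x∣ _) (proj₂ (cauchy ε 0<ε) n k (ℕ.m≤m⊔n N M) N≤k))))
        where
        N n : ℕ
        N = proj₁ (cauchy ε 0<ε)
        n = N ℕ.⊔ M

    limit : ∃ (IsSupremum Below)
    limit = sup Below (_ , below 0<1 _ ℕ.≤-refl) (_ , above 0<1 _ ℕ.≤-refl)

    lim : Carrier
    lim = proj₁ limit

    lim-close : ∀ ε (0<ε : 0# < ε) k → proj₁ (cauchy ε 0<ε) ℕ.≤ k →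
                ∣ a k + - lim ∣ ≤ ε
    lim-close ε 0<ε k N≤k = ∣∣-lub
      (x≤z+y⇒x-y≤z (≤-resp refl (+-comm lim ε)
        (x-y≤z⇒x≤z+y (proj₁ (proj₂ limit) _ (below 0<ε k N≤k)))))
      (≤-resp (sym (neg-sub (a k) lim)) refl
        (x≤z+y⇒x-y≤z (≤-resp refl (+-comm (a k) ε)
          (proj₂ (proj₂ limit) _ (above 0<ε k N≤k)))))

  module _ (X : Setoid i e) where

    private
      module X = Setoid X
    open Func using (to; cong)

    Fun : Set (i ⊔ e)
    Fun = Func X setoid

    zeroᶠ : Fun
    zeroᶠ = record { to = λ _ → 0# ; cong = λ _ → refl }

    addᶠ : Fun → Fun → Fun
    addᶠ f g = record
      { to = λ x → to f x + to g x ; cong = λ q → +-cong (cong f q) (cong g q) }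

    scaleᶠ : Carrier → Fun → Fun
    scaleᶠ a f = record { to = λ x → a * to f x ; cong = λ q → *-congˡ (cong f q) }

    negᶠ : Fun → Fun
    negᶠ f = record { to = λ x → - to f x ; cong = λ q → -‿cong (cong f q) }

    -- A linear space of bounded functions closed under uniform limits; with
    -- the sup norm it is a Banach space.
    record FunctionSpace p : Set (i ⊔ e ⊔ suc p) where
      field
        Member       : Pred Fun p
        member⇒bdd   : ∀ f → Member f → ∃ λ C → ∀ x → ∣ to f x ∣ ≤ C
        zero-closed  : Member zeroᶠ
        add-closed   : ∀ f g → Member f → Member g → Member (addᶠ f g)
        scale-closed : ∀ a f → Member f → Member (scaleᶠ a f)
        limit-closed : ∀ f → (∀ ε → 0# < ε → ∃ λ g →
                         Member g × (∀ x → ∣ to f x + - to g x ∣ ≤ ε)) → Member f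

      Elem : Set (i ⊔ e ⊔ p)
      Elem = Σ Fun Member

      _≗_ : Rel Elem i
      f ≗ g = ∀ x → to (proj₁ f) x ≈ to (proj₁ g) x

      neg-closed : ∀ f → Member f → Member (negᶠ f)
      neg-closed f f∈ = limit-closed (negᶠ f) λ ε 0<ε →
        scaleᶠ (- 1#) f , scale-closed (- 1#) f f∈ , λ x →
          ≤-resp (sym (trans (∣∣-cong (trans
            (+-congˡ (-‿cong (trans (sym (-‿distribˡ-* 1# (to f x)))
              (-‿cong (*-identityˡ (to f x))))))
            (-‿inverseʳ (- to f x)))) ∣0∣)) refl (proj₁ 0<ε)

      vectorSpace : LeftModule ring (i ⊔ e ⊔ p) i
      vectorSpace = record
        { Carrierᴹ = Elem
        ; _≈ᴹ_     = _≗_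
        ; _+ᴹ_     = λ (f , f∈) (g , g∈) → addᶠ f g , add-closed f g f∈ g∈
        ; _*ₗ_     = λ a (f , f∈) → scaleᶠ a f , scale-closed a f f∈
        ; 0ᴹ       = zeroᶠ , zero-closed
        ; -ᴹ_      = λ (f , f∈) → negᶠ f , neg-closed f f∈
        ; isLeftModule = record
          { isLeftSemimodule = record
            { +ᴹ-isCommutativeMonoid = record
              { isMonoid = record
                { isSemigroup = record
                  { isMagma = record
                    { isEquivalence = record
                      { refl  = λ _ → refl
                      ; sym   = λ q x → sym (q x)
                      ; trans = λ q r x → trans (q x) (r x)
                      }
                    ; ∙-cong = λ q r x → +-cong (q x) (r x)
                    }
                  ; assoc = λ _ _ _ _ → +-assoc _ _ _
                  }
                ; identity = (λ _ _ → +-identityˡ _) , (λ _ _ → +-identityʳ _)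
                }
              ; comm = λ _ _ _ → +-comm _ _
              }
            ; isPreleftSemimodule = record
              { *ₗ-cong      = λ q r x → *-cong q (r x)
              ; *ₗ-zeroˡ     = λ _ _ → zeroˡ _
              ; *ₗ-distribʳ  = λ _ _ _ _ → distribʳ _ _ _
              ; *ₗ-identityˡ = λ _ _ → *-identityˡ _
              ; *ₗ-assoc     = λ _ _ _ _ → *-assoc _ _ _
              ; *ₗ-zeroʳ     = λ _ _ → zeroʳ _
              ; *ₗ-distribˡ  = λ _ _ _ _ → distribˡ _ _ _
              }
            }
          ; -ᴹ‿cong    = λ q x → -‿cong (q x)
          ; -ᴹ‿inverse = (λ _ _ → -‿inverseˡ _) , (λ _ _ → -‿inverseʳ _)
          }
        }

      -- Including 0 only matters for empty X, where the norm must be 0.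
      AbsValues : Elem → Pred Carrier i
      AbsValues (f , _) r = r ≈ 0# ⊎ ∃ λ x → r ≈ ∣ to f x ∣

      supAbs : ∀ f → ∃ (IsSupremum (AbsValues f))
      supAbs f = sup (AbsValues f) (0# , inj₁ refl) (b ∨ 0# , ub)
        where
        b : Carrier
        b = proj₁ (member⇒bdd (proj₁ f) (proj₂ f))
        ub : UpperBound (AbsValues f) (b ∨ 0#)
        ub r (inj₁ r≈0)      = ≤-trans (≈⇒≤ r≈0) (y≤x∨y b 0#)
        ub r (inj₂ (x , r≈)) = ≤-trans (≈⇒≤ r≈) (≤-trans
          (proj₂ (member⇒bdd (proj₁ f) (proj₂ f)) x) (x≤x∨y b 0#))

      norm : Elem → Carrier
      norm f = proj₁ (supAbs f)

      ∣f∣≤norm : ∀ f x → ∣ to (proj₁ f) x ∣ ≤ norm f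
      ∣f∣≤norm f x = proj₁ (proj₂ (supAbs f)) _ (inj₂ (x , refl))

      norm-nonneg : ∀ f → 0# ≤ norm f
      norm-nonneg f = proj₁ (proj₂ (supAbs f)) _ (inj₁ refl)

      norm-lub : ∀ f {c} → 0# ≤ c → (∀ x → ∣ to (proj₁ f) x ∣ ≤ c) → norm f ≤ c
      norm-lub f {c} 0≤c h = proj₂ (proj₂ (supAbs f)) c λ where
        r (inj₁ r≈0)      → ≤-trans (≈⇒≤ r≈0) 0≤c
        r (inj₂ (x , r≈)) → ≤-trans (≈⇒≤ r≈) (h x)

      open LeftModule vectorSpace using (_+ᴹ_; _*ₗ_; 0ᴹ; -ᴹ_)

      norm-mono : ∀ f g → (∀ x → ∣ to (proj₁ f) x ∣ ≤ ∣ to (proj₁ g) x ∣) →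
                  norm f ≤ norm g
      norm-mono f g h = norm-lub f (norm-nonneg g) λ x → ≤-trans (h x) (∣f∣≤norm g x)

      norm-cong : ∀ {f g} → f ≗ g → norm f ≈ norm g
      norm-cong {f} {g} q = O.antisym
        (norm-mono f g λ x → ≈⇒≤ (∣∣-cong (q x)))
        (norm-mono g f λ x → ≈⇒≤ (∣∣-cong (sym (q x))))

      norm-definite : ∀ f → norm f ≈ 0# → f ≗ 0ᴹ
      norm-definite f q x = ∣∣-definite _ (≤-trans (∣f∣≤norm f x) (≈⇒≤ q))

      norm-scale-≤ : ∀ a f → norm (a *ₗ f) ≤ ∣ a ∣ * norm f
      norm-scale-≤ a f = norm-lub (a *ₗ f) (*-nonneg (∣∣-nonneg a) (norm-nonneg f))
        λ x → ≤-resp (sym (∣∣-* a _)) refl (*-monoˡ-≤ (∣∣-nonneg a) (∣f∣≤norm f x))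

      norm-homo : ∀ a f → norm (a *ₗ f) ≈ ∣ a ∣ * norm f
      norm-homo a f = O.antisym (norm-scale-≤ a f) (lower em)
        where
        lower : Dec (a ≈ 0#) → ∣ a ∣ * norm f ≤ norm (a *ₗ f)
        lower (yes a≈0) = ≤-resp
          (sym (trans (*-congʳ (trans (∣∣-cong a≈0) ∣0∣)) (zeroˡ _))) refl
          (norm-nonneg (a *ₗ f))
        lower (no a≉0) with inverse a a≉0
        ... | b , ab≈1 = ≤-resp refl one
          (*-monoˡ-≤ (∣∣-nonneg a) (≤-trans (≈⇒≤ back) (norm-scale-≤ b (a *ₗ f))))
          where
          back : norm f ≈ norm (b *ₗ (a *ₗ f))
          back = norm-cong {f} {b *ₗ (a *ₗ f)} λ x → sym (trans (sym (*-assoc b a _))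
            (trans (*-congʳ (trans (*-comm b a) ab≈1)) (*-identityˡ _)))
          one : ∣ a ∣ * (∣ b ∣ * norm (a *ₗ f)) ≈ norm (a *ₗ f)
          one = trans (sym (*-assoc _ _ _)) (trans (*-congʳ
            (trans (sym (∣∣-* a b)) (trans (∣∣-cong ab≈1) (nonneg⇒∣∣ 0≤1))))
            (*-identityˡ _))

      norm-triangle : ∀ f g → norm (f +ᴹ g) ≤ norm f + norm g
      norm-triangle f g = norm-lub (f +ᴹ g)
        (≤-trans (norm-nonneg f) (x≤x+nonneg (norm-nonneg g)))
        λ x → ≤-trans (∣∣-triangle _ _) (+-mono-≤ (∣f∣≤norm f x) (∣f∣≤norm g x))

      normedSpace : NormedSpace ℝ (i ⊔ e ⊔ p) i
      normedSpace = record
        { vectorSpace = vectorSpace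
        ; ‖_‖         = norm
        ; ‖‖-cong     = λ {f} {g} → norm-cong {f} {g}
        ; ‖‖-nonneg   = norm-nonneg
        ; ‖‖-definite = norm-definite
        ; ‖‖-homo     = norm-homo
        ; ‖‖-triangle = norm-triangle
        }

      open NormedSpace normedSpace using (Cauchy; ConvergesTo)

      ∣f-g∣≤norm : ∀ f g x →
        ∣ to (proj₁ f) x + - to (proj₁ g) x ∣ ≤ norm (f +ᴹ -ᴹ g)
      ∣f-g∣≤norm f g = ∣f∣≤norm (f +ᴹ -ᴹ g)

      norm-sub-lub : ∀ f g {c} → 0# ≤ c →
        (∀ x → ∣ to (proj₁ f) x + - to (proj₁ g) x ∣ ≤ c) → norm (f +ᴹ -ᴹ g) ≤ c
      norm-sub-lub f g = norm-lub (f +ᴹ -ᴹ g)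

      module _ (f : ℕ → Elem) (cauchy : Cauchy f) where

        at : X.Carrier → ℕ → Carrier
        at x n = to (proj₁ (f n)) x

        cauchy-at : ∀ x ε → 0# < ε →
          ∃ λ N → ∀ j k → N ℕ.≤ j → N ℕ.≤ k → ∣ at x j + - at x k ∣ ≤ ε
        cauchy-at x ε 0<ε = proj₁ (cauchy ε 0<ε) , λ j k N≤j N≤k →
          ≤-trans (∣f-g∣≤norm (f j) (f k) x)
            (proj₁ (proj₂ (cauchy ε 0<ε) j k N≤j N≤k))

        limit-at : ∀ x → ∃ (IsSupremum (Limit.Below (at x) (cauchy-at x)))
        limit-at x = Limit.limit (at x) (cauchy-at x)

        limit-at-close : ∀ x ε (0<ε : 0# < ε) k → proj₁ (cauchy ε 0<ε) ℕ.≤ k →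
          ∣ at x k + - proj₁ (limit-at x) ∣ ≤ ε
        limit-at-close x = Limit.lim-close (at x) (cauchy-at x)

        limit-at-mono : ∀ {x y} → x X.≈ y →
          proj₁ (limit-at x) ≤ proj₁ (limit-at y)
        limit-at-mono {x} {y} q = proj₂ (proj₂ (limit-at x)) (proj₁ (limit-at y))
          λ r (N , r≤) → proj₁ (proj₂ (limit-at y)) r
            (N , λ n N≤n → ≤-trans (r≤ n N≤n) (≈⇒≤ (cong (proj₁ (f n)) q)))

        limᶠ : Fun
        limᶠ = record
          { to   = λ x → proj₁ (limit-at x)
          ; cong = λ q → O.antisym (limit-at-mono q) (limit-at-mono (X.sym q))
          }

        limᶠ-member : Member limᶠ
        limᶠ-member = limit-closed limᶠ λ ε 0<ε →
          let N = proj₁ (cauchy ε 0<ε) in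
          proj₁ (f N) , proj₂ (f N) , λ x →
            ≤-resp (∣sub∣-comm (at x N) (proj₁ (limit-at x))) refl
              (limit-at-close x ε 0<ε N ℕ.≤-refl)

        converges : ConvergesTo f (limᶠ , limᶠ-member)
        converges ε 0<ε =
          let δ , 0<δ , δ+δ≈ε = half 0<ε in
          proj₁ (cauchy δ 0<δ) , λ k N≤k → ≤-<-trans
            (norm-sub-lub (f k) (limᶠ , limᶠ-member) (proj₁ 0<δ)
              (λ x → limit-at-close x δ 0<δ k N≤k))
            (half<whole 0<δ δ+δ≈ε)

      complete : ∀ f → Cauchy f → ∃ (ConvergesTo f)
      complete f cauchy = (limᶠ f cauchy , limᶠ-member f cauchy) , converges f cauchy

      banachSpace : BanachSpace ℝ (i ⊔ e ⊔ p) i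
      banachSpace = record { normedSpace = normedSpace ; complete = complete }

  module _ (K : TopologicalSpace ℓ) where

    open TopologicalSpace K
    open Func using (to)

    Continuous : Func points setoid → Set (suc ℓ)
    Continuous f = ∀ x ε → 0# < ε → ∃ λ V → IsOpen V × x ∈ V ×
      (∀ y → y ∈ V → ∣ to f y + - to f x ∣ < ε)

    continuousFunctions : Compact K → FunctionSpace points (suc ℓ)
    continuousFunctions compact = record
      { Member       = Continuous
      ; member⇒bdd   = bdd
      ; zero-closed  = λ x ε 0<ε → (λ _ → ⊤) , open-whole (λ _ → tt) , tt ,
          λ _ _ → ≤-<-trans (≈⇒≤ (trans (∣∣-cong (-‿inverseʳ 0#)) ∣0∣)) 0<ε
      ; add-closed   = add
      ; scale-closed = scale
      ; limit-closed = closed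
      }
      where
      bdd : ∀ f → Continuous f → ∃ λ C → ∀ x → ∣ to f x ∣ ≤ C
      bdd f cont = bound (proj₁ cover) , λ x → below (proj₁ cover) x (proj₂ cover x)
        where
        V : Point → Pred Point _
        V x = proj₁ (cont x 1# 0<1)
        cover : ∃ λ (js : List Point) → ∀ x → Any (λ j → x ∈ V j) js
        cover = compact Point V (λ x → proj₁ (proj₂ (cont x 1# 0<1)))
          (λ x → x , proj₁ (proj₂ (proj₂ (cont x 1# 0<1))))
        bound : List Point → Carrier
        bound []       = 0#
        bound (j ∷ js) = (1# + ∣ to f j ∣) ∨ bound js
        below : ∀ js x → Any (λ j → x ∈ V j) js → ∣ to f x ∣ ≤ bound js
        below (j ∷ js) x (here x∈V) = ≤-trans
          (∣x∣≤∣x-y∣+∣y∣ (proj₁ (proj₂ (proj₂ (proj₂ (cont j 1# 0<1))) x x∈V)))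
          (x≤x∨y _ _)
        below (j ∷ js) x (there q) = ≤-trans (below js x q) (y≤x∨y _ _)

      add : ∀ f g → Continuous f → Continuous g → Continuous (addᶠ points f g)
      add f g cf cg x ε 0<ε with half 0<ε
      ... | δ , 0<δ , δ+δ≈ε with cf x δ 0<δ | cg x δ 0<δ
      ... | V , V-open , x∈V , hf | W , W-open , x∈W , hg =
        V ∩ W , open-∩ V-open W-open , (x∈V , x∈W) , λ y (y∈V , y∈W) →
          ≤-<-trans (≤-resp (∣∣-cong (sub-add _ _ _ _)) refl (∣∣-triangle _ _))
            (<-≤-trans (+-mono-< (hf y y∈V) (hg y y∈W)) (≈⇒≤ δ+δ≈ε))

      scale : ∀ a f → Continuous f → Continuous (scaleᶠ points a f)
      scale a f cf x ε 0<ε =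
        let δ , 0<δ , ∣a∣δ<ε = scaled a 0<ε
            V , V-open , x∈V , hf = cf x δ 0<δ
        in V , V-open , x∈V , λ y y∈V → ≤-<-trans
          (≤-resp
            (sym (trans (∣∣-cong (sub-scale a (to f y) (to f x))) (∣∣-* a _))) refl
            (*-monoˡ-≤ (∣∣-nonneg a) (proj₁ (hf y y∈V)))) ∣a∣δ<ε

      closed : ∀ f → (∀ ε → 0# < ε → ∃ λ g →
        Continuous g × (∀ x → ∣ to f x + - to g x ∣ ≤ ε)) → Continuous f
      closed f approx x ε 0<ε with half 0<ε
      ... | δ , 0<δ , δ+δ≈ε with half 0<δ
      ... | η , 0<η , η+η≈δ with approx η 0<η
      ... | g , cg , close with cg x δ 0<δ
      ... | V , V-open , x∈V , hg = V , V-open , x∈V , λ y y∈V →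
        ≤-<-trans
          (≤-trans (∣sub∣-trans (to f y) (to g y) (to f x))
            (+-mono-≤ (close y) (∣sub∣-trans (to g y) (to g x) (to f x))))
          (≤-<-trans
            (+-mono-≤ ≤-refl (+-mono-≤ ≤-refl (≤-resp (∣sub∣-comm _ _) refl (close x))))
            (<-≤-trans (+-monoʳ-< η (+-monoˡ-< η (hg y y∈V)))
              (≈⇒≤ (trans (rearrange η δ) (trans (+-congʳ η+η≈δ) δ+δ≈ε)))))

    C : Compact K → BanachSpace ℝ (suc ℓ) ℓ
    C compact = FunctionSpace.banachSpace (continuousFunctions compact)

  module _ (I : Setoid i e) where

    open ListMembership I using () renaming (_∈_ to _∈ᴸ_)
    open Func using (to)

    -- A subset of I is finite when some list contains all its elements.
    IsFinite : Pred (Setoid.Carrier I) p → Set (i ⊔ e ⊔ p)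
    IsFinite A = ∃ λ js → ∀ x → x ∈ A → x ∈ᴸ js

    Vanishing : Func I setoid → Set (i ⊔ e)
    Vanishing f = ∀ ε → 0# < ε → IsFinite (λ x → ε < ∣ to f x ∣)

    vanishingFunctions : FunctionSpace I (i ⊔ e)
    vanishingFunctions = record
      { Member       = Vanishing
      ; member⇒bdd   = bdd
      ; zero-closed  = λ ε 0<ε → [] , λ x ε<0 →
          ⊥-elim (<⇒≱ (<-≤-trans ε<0 (≈⇒≤ ∣0∣)) (proj₁ 0<ε))
      ; add-closed   = add
      ; scale-closed = scale
      ; limit-closed = closed
      }
      where
      bdd : ∀ f → Vanishing f → ∃ λ C → ∀ x → ∣ to f x ∣ ≤ C
      bdd f vf = bound js , λ x → below x em
        where
        js : List (Setoid.Carrier I)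
        js = proj₁ (vf 1# 0<1)
        bound : List (Setoid.Carrier I) → Carrier
        bound []       = 1#
        bound (j ∷ js) = ∣ to f j ∣ ∨ bound js
        1≤bound : ∀ js → 1# ≤ bound js
        1≤bound []       = ≤-refl
        1≤bound (j ∷ js) = ≤-trans (1≤bound js) (y≤x∨y _ _)
        listed : ∀ x js → x ∈ᴸ js → ∣ to f x ∣ ≤ bound js
        listed x (j ∷ js) (here x≈j) = ≤-trans (≈⇒≤ (∣∣-cong (Func.cong f x≈j))) (x≤x∨y _ _)
        listed x (j ∷ js) (there q)  = ≤-trans (listed x js q) (y≤x∨y _ _)
        below : ∀ x → Dec (∣ to f x ∣ ≤ 1#) → ∣ to f x ∣ ≤ bound js
        below x (yes q) = ≤-trans q (1≤bound js)
        below x (no q)  = listed x js (proj₂ (vf 1# 0<1) x (≰⇒> q))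

      add : ∀ f g → Vanishing f → Vanishing g → Vanishing (addᶠ I f g)
      add f g vf vg ε 0<ε with half 0<ε
      ... | δ , 0<δ , δ+δ≈ε = js ++ ks , λ x ε< → split x ε< em em
        where
        js ks : List (Setoid.Carrier I)
        js = proj₁ (vf δ 0<δ)
        ks = proj₁ (vg δ 0<δ)
        split : ∀ x → ε < ∣ to f x + to g x ∣ →
          Dec (∣ to f x ∣ ≤ δ) → Dec (∣ to g x ∣ ≤ δ) → x ∈ᴸ (js ++ ks)
        split x ε< (no q)  _       = ++⁺ˡ (proj₂ (vf δ 0<δ) x (≰⇒> q))
        split x ε< (yes _) (no q)  = ++⁺ʳ js (proj₂ (vg δ 0<δ) x (≰⇒> q))
        split x ε< (yes q) (yes r) = ⊥-elim (<⇒≱ ε<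
          (≤-trans (∣∣-triangle _ _) (≤-resp refl δ+δ≈ε (+-mono-≤ q r))))

      scale : ∀ a f → Vanishing f → Vanishing (scaleᶠ I a f)
      scale a f vf ε 0<ε =
        let δ , 0<δ , ∣a∣δ<ε = scaled a 0<ε
        in proj₁ (vf δ 0<δ) , λ x ε< → listed δ ∣a∣δ<ε x ε< (proj₂ (vf δ 0<δ) x) em
        where
        listed : ∀ δ → ∣ a ∣ * δ < ε → ∀ x → ε < ∣ a * to f x ∣ → ∀ {js} →
          (δ < ∣ to f x ∣ → x ∈ᴸ js) → Dec (∣ to f x ∣ ≤ δ) → x ∈ᴸ js
        listed δ ∣a∣δ<ε x ε< h (no q)  = h (≰⇒> q)
        listed δ ∣a∣δ<ε x ε< h (yes q) = ⊥-elim (<⇒≱ ε<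
          (≤-resp (sym (∣∣-* a (to f x))) refl
            (≤-trans (*-monoˡ-≤ (∣∣-nonneg a) q) (proj₁ ∣a∣δ<ε))))

      closed : ∀ f → (∀ ε → 0# < ε → ∃ λ g →
        Vanishing g × (∀ x → ∣ to f x + - to g x ∣ ≤ ε)) → Vanishing f
      closed f approx ε 0<ε with half 0<ε
      ... | δ , 0<δ , δ+δ≈ε with approx δ 0<δ
      ... | g , vg , close = proj₁ (vg δ 0<δ) , λ x ε< → listed x ε< em
        where
        listed : ∀ x → ε < ∣ to f x ∣ → Dec (∣ to g x ∣ ≤ δ) → x ∈ᴸ proj₁ (vg δ 0<δ)
        listed x ε< (no q)  = proj₂ (vg δ 0<δ) x (≰⇒> q)
        listed x ε< (yes q) = ⊥-elim (<⇒≱ ε<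
          (≤-trans (∣x∣≤∣x-y∣+∣y∣ (close x)) (≤-resp refl δ+δ≈ε (+-mono-≤ ≤-refl q))))

    c₀ : BanachSpace ℝ (i ⊔ e) i
    c₀ = FunctionSpace.banachSpace vanishingFunctions

{-# OPTIONS --safe #-}
-- Index the tunnel as (V k), k ∈ κ, and let Z consist of the functions on K that jump by
-- c k across ∂ (V k) and are otherwise continuous, paired with their jumps c ∈ c₀(κ).
-- The projection to c has kernel C(K).  It is onto: finitely many distinct V k can be cut off
-- by Urysohn functions so that the differences χ (V k) − g k have disjoint supports, which
-- lifts finitely supported c with control of the norm, and a geometric series does the rest.
--
-- If ϖ were a left inverse of ι, then T = 1 − ι ϖ would depend only on the jumps, so T z
-- would be bounded over all z whose jumps have modulus at most 1.  But near a point of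
-- ∂ (V k) the function T (χ (V k)) takes values that differ by 1 on the two sides, hence it
-- is at least ¼ in modulus on some nonempty open set; there a further boundary is available,
-- and adding such functions with suitable signs makes T z arbitrarily large.
module Submission where

open import Defs
open import Algebra.Bundles using (CommutativeRing; RawRing)
open import Algebra.Module.Morphism.Structures using (module LeftModuleMorphisms)
import Algebra.Properties.Ring as RingProperties
import Algebra.Properties.Semiring.Mult.TCOptimised as Mult
import Algebra.Solver.Ring as RingSolver
open import Algebra.Solver.Ring.AlmostCommutativeRing
  using (fromCommutativeRing; _-Raw-AlmostCommutative⟶_)
open import Axiom.ExcludedMiddle using (ExcludedMiddle)
open import Data.Bool.Base using (Bool; true; false; if_then_else_)
open import Data.Empty using (⊥; ⊥-elim)
import Data.Empty.Polymorphic as Polymorphic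
open import Data.List.Base using (List; []; _∷_)
import Data.List.Membership.Setoid as ListMembership
open import Data.List.Membership.Setoid.Properties using (∈-resp-≈)
open import Data.List.Relation.Unary.Any as Any using (Any; here; there)
open import Data.Maybe.Base using (Maybe; just; nothing)
open import Data.Nat.Base as ℕ using (ℕ; zero)
import Data.Nat.Properties as ℕ
open import Data.Product.Base using (∃; _×_; _,_; proj₁; proj₂)
open import Data.Sum.Base using (_⊎_; inj₁; inj₂; [_,_]′)
open import Data.Sum.Relation.Binary.Pointwise as Pointwise using (⊎-setoid)
open import Data.Unit.Polymorphic.Base using (⊤; tt)
open import Function.Bundles using (Func; Bijection)
open import Level using (Level; 0ℓ; _⊔_; suc; Lift; lift)
open import Relation.Binary.Bundles using (Setoid)
open import Relation.Binary.PropositionalEquality.Core as ≡ using (_≡_)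
open import Relation.Binary.Structures using (IsTotalOrder)
open import Relation.Nullary using (¬_; Dec; yes; no)
open import Relation.Nullary.Decidable using (decidable-stable)
open import Relation.Unary
  using (Pred; _∈_; _∉_; _⊆_; _≐_; _∩_; _∪_; ∁; _≬_; Universal)

-- Ring solving with integer coefficients.

-- The coefficients (m , n) stand for the integers m − n.
module IntegerCoefficients {c ℓ} (R : CommutativeRing c ℓ) where

  open CommutativeRing R
  open RingProperties ring
    using (-‿distribˡ-*; -‿distribʳ-*; -‿involutive; -0#≈0#; -‿+-comm)
  open import Algebra.Properties.CommutativeSemigroup +-commutativeSemigroup
    using (interchange)
  open import Relation.Binary.Reasoning.Setoid setoid
  open Mult semiring using (×-homo-+; ×1-homo-*) renaming (_×_ to _·_)

  cancel : ℕ × ℕ → ℕ × ℕ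
  cancel (ℕ.suc m , ℕ.suc n) = cancel (m , n)
  cancel p                   = p

  -- Cancelling makes equal coefficients identical.
  differences : RawRing 0ℓ 0ℓ
  differences = record
    { Carrier = ℕ × ℕ
    ; _≈_     = _≡_
    ; _+_     = λ (m , n) (k , l) → cancel (m ℕ.+ k , n ℕ.+ l)
    ; _*_     = λ (m , n) (k , l) → cancel (m ℕ.* k ℕ.+ n ℕ.* l , m ℕ.* l ℕ.+ n ℕ.* k)
    ; -_      = λ (m , n) → n , m
    ; 0#      = 0 , 0
    ; 1#      = 1 , 0
    }

  -- The case distinction makes the constants 0 and 1 evaluate to 0# and 1#.
  value : ℕ × ℕ → Carrier
  value (m , zero)        = m · 1#
  value (m , n@(ℕ.suc _)) = m · 1# + - (n · 1#)

  value≈ : ∀ m n → value (m , n) ≈ m · 1# + - (n · 1#)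
  value≈ m zero      = sym (trans (+-congˡ -0#≈0#) (+-identityʳ (m · 1#)))
  value≈ m (ℕ.suc n) = refl

  value-+ : ∀ m n k l →
    value (m ℕ.+ k , n ℕ.+ l) ≈ value (m , n) + value (k , l)
  value-+ m n k l = begin
    value (m ℕ.+ k , n ℕ.+ l)                     ≈⟨ value≈ (m ℕ.+ k) (n ℕ.+ l) ⟩
    (m ℕ.+ k) · 1# + - ((n ℕ.+ l) · 1#)
      ≈⟨ +-cong (×-homo-+ 1# m k) (-‿cong (×-homo-+ 1# n l)) ⟩
    (m · 1# + k · 1#) + - (n · 1# + l · 1#)       ≈⟨ +-congˡ (-‿+-comm _ _) ⟨
    (m · 1# + k · 1#) + (- (n · 1#) + - (l · 1#)) ≈⟨ interchange _ _ _ _ ⟩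
    (m · 1# + - (n · 1#)) + (k · 1# + - (l · 1#)) ≈⟨ +-cong (value≈ m n) (value≈ k l) ⟨
    value (m , n) + value (k , l)                 ∎

  value-neg : ∀ m n → value (n , m) ≈ - value (m , n)
  value-neg m n = begin
    value (n , m)                ≈⟨ value≈ n m ⟩
    n · 1# + - (m · 1#)          ≈⟨ +-comm _ _ ⟩
    - (m · 1#) + n · 1#          ≈⟨ +-congˡ (-‿involutive _) ⟨
    - (m · 1#) + - - (n · 1#)    ≈⟨ -‿+-comm _ _ ⟩
    - (m · 1# + - (n · 1#))      ≈⟨ -‿cong (value≈ m n) ⟨
    - value (m , n)              ∎

  value-* : ∀ m n k l → value (m ℕ.* k ℕ.+ n ℕ.* l , m ℕ.* l ℕ.+ n ℕ.* k) ≈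
    value (m , n) * value (k , l)
  value-* m n k l = begin
    value (m ℕ.* k ℕ.+ n ℕ.* l , m ℕ.* l ℕ.+ n ℕ.* k)
      ≈⟨ value-+ (m ℕ.* k) (m ℕ.* l) (n ℕ.* l) (n ℕ.* k) ⟩
    value (m ℕ.* k , m ℕ.* l) + value (n ℕ.* l , n ℕ.* k)
      ≈⟨ +-cong (scale m k l) (trans (value-neg (n ℕ.* k) (n ℕ.* l)) (-‿cong (scale n k l))) ⟩
    m · 1# * value (k , l) + - (n · 1# * value (k , l))
      ≈⟨ +-congˡ (-‿distribˡ-* _ _) ⟩
    m · 1# * value (k , l) + - (n · 1#) * value (k , l)
      ≈⟨ distribʳ _ _ _ ⟨
    (m · 1# + - (n · 1#)) * value (k , l)
      ≈⟨ *-congʳ (value≈ m n) ⟨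
    value (m , n) * value (k , l) ∎
    where
    scale : ∀ m k l → value (m ℕ.* k , m ℕ.* l) ≈ m · 1# * value (k , l)
    scale m k l = begin
      value (m ℕ.* k , m ℕ.* l)               ≈⟨ value≈ (m ℕ.* k) (m ℕ.* l) ⟩
      (m ℕ.* k) · 1# + - ((m ℕ.* l) · 1#)
        ≈⟨ +-cong (×1-homo-* m k) (-‿cong (×1-homo-* m l)) ⟩
      m · 1# * k · 1# + - (m · 1# * l · 1#)   ≈⟨ +-congˡ (-‿distribʳ-* _ _) ⟩
      m · 1# * k · 1# + m · 1# * - (l · 1#)   ≈⟨ distribˡ _ _ _ ⟨
      m · 1# * (k · 1# + - (l · 1#))          ≈⟨ *-congˡ (value≈ k l) ⟨
      m · 1# * value (k , l)                  ∎

  -- Padding with `value (l , l)` on the left and `value (n , n)` on the right, both zero, turns the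
  -- two pairs into the same one.
  value-cong : ∀ m n k l → m ℕ.+ l ≡ k ℕ.+ n → value (m , n) ≈ value (k , l)
  value-cong m n k l eq = begin
    value (m , n)                       ≈⟨ +-identityʳ _ ⟨
    value (m , n) + 0#                  ≈⟨ +-congˡ (null l) ⟨
    value (m , n) + value (l , l)       ≈⟨ value-+ m n l l ⟨
    value (m ℕ.+ l , n ℕ.+ l)           ≡⟨ ≡.cong₂ (λ p q → value (p , q)) eq (ℕ.+-comm n l) ⟩
    value (k ℕ.+ n , l ℕ.+ n)           ≈⟨ value-+ k l n n ⟩
    value (k , l) + value (n , n)       ≈⟨ +-congˡ (null n) ⟩
    value (k , l) + 0#                  ≈⟨ +-identityʳ _ ⟩
    value (k , l)                       ∎
    where
    null : ∀ n → value (n , n) ≈ 0#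
    null n = trans (value≈ n n) (-‿inverseʳ _)

  value-cancel : ∀ m n → value (cancel (m , n)) ≈ value (m , n)
  value-cancel zero      zero      = refl
  value-cancel zero      (ℕ.suc n) = refl
  value-cancel (ℕ.suc m) zero      = refl
  value-cancel (ℕ.suc m) (ℕ.suc n) = trans (value-cancel m n)
    (value-cong m n (ℕ.suc m) (ℕ.suc n) (ℕ.+-suc m n))

  evaluation : differences -Raw-AlmostCommutative⟶ fromCommutativeRing R
  evaluation = record
    { ⟦_⟧    = value
    ; +-homo = λ (m , n) (k , l) →
        trans (value-cancel (m ℕ.+ k) (n ℕ.+ l)) (value-+ m n k l)
    ; *-homo = λ (m , n) (k , l) →
        trans (value-cancel (m ℕ.* k ℕ.+ n ℕ.* l) (m ℕ.* l ℕ.+ n ℕ.* k)) (value-* m n k l)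
    ; -‿homo = λ (m , n) → value-neg m n
    ; 0-homo = refl
    ; 1-homo = refl
    }

  coefficientwise : ∀ p q → Maybe (value p ≈ value q)
  coefficientwise (m , n) (k , l) with m ℕ.+ l ℕ.≟ k ℕ.+ n
  ... | yes eq = just (value-cong m n k l eq)
  ... | no _   = nothing

  open RingSolver differences (fromCommutativeRing R) evaluation coefficientwise public
    using (solve; _:=_; _:+_; _:*_; :-_)

-- Separation properties of compact Hausdorff spaces.

module Topology (em : ∀ {a} → ExcludedMiddle a) {ℓ} (K : TopologicalSpace ℓ) where

  open TopologicalSpace K

  private
    variable
      p : Level
      A B : Pred Point p
      V W : Pred Point ℓ
      x : Point

  interior-∩ : x ∈ interior K A → x ∈ interior K B → x ∈ interior K (A ∩ B)
  interior-∩ (V , V-open , x∈V , V⊆A) (W , W-open , x∈W , W⊆B) =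
    V ∩ W , open-∩ V-open W-open , (x∈V , x∈W) , λ (y∈V , y∈W) → V⊆A y∈V , W⊆B y∈W

  interior-mono : A ⊆ B → interior K A ⊆ interior K B
  interior-mono A⊆B (V , V-open , x∈V , V⊆A) = V , V-open , x∈V , λ y∈V → A⊆B (V⊆A y∈V)

  interior-⊆ : interior K A ⊆ A
  interior-⊆ (V , _ , x∈V , V⊆A) = V⊆A x∈V

  universal⇒interior : Universal A → Universal (interior K A)
  universal⇒interior u x = (λ _ → ⊤) , open-whole (λ _ → tt) , tt , λ _ → u _

  open⇒interior : IsOpen V → V ⊆ interior K V
  open⇒interior V-open x∈V = _ , V-open , x∈V , λ y∈V → y∈V

  ⊆closure : A ⊆ closure K A
  ⊆closure x∈A V V-open x∈V = _ , x∈V , x∈A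

  closure-mono : A ⊆ B → closure K A ⊆ closure K B
  closure-mono A⊆B x∈clA V V-open x∈V with x∈clA V V-open x∈V
  ... | y , y∈V , y∈A = y , y∈V , A⊆B y∈A

  ⋖-monoˡ : ∀ {V V′ W} → V′ ⊆ V → _⋖_ K V W → _⋖_ K V′ W
  ⋖-monoˡ V′⊆V V⋖W x∈cl = V⋖W (closure-mono V′⊆V x∈cl)

  ∉closure⇒interior : x ∉ closure K A → x ∈ interior K (∁ A)
  ∉closure⇒interior {x = x} {A = A} x∉ with em {P = x ∈ interior K (∁ A)}
  ... | yes x∈int = x∈int
  ... | no  x∉int = ⊥-elim (x∉ λ V V-open x∈V → meets V V-open x∈V em)
    where
    meets : ∀ V → IsOpen V → x ∈ V → Dec (V ≬ A) → V ≬ A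
    meets V V-open x∈V (yes V≬A) = V≬A
    meets V V-open x∈V (no ¬V≬A) =
      ⊥-elim (x∉int (V , V-open , x∈V , λ y∈V y∈A → ¬V≬A (_ , y∈V , y∈A)))

  ∂-disjoint : IsOpen V → x ∈ ∂ K V → x ∉ V
  ∂-disjoint V-open (_ , x∈cl∁) x∈V with x∈cl∁ _ V-open x∈V
  ... | _ , y∈V , y∉V = y∉V y∈V

  ∂-resp-≐ : A ≐ B → ∂ K A ⊆ ∂ K B
  ∂-resp-≐ (A⊆B , B⊆A) (x∈cl , x∈cl∁) =
    closure-mono A⊆B x∈cl , closure-mono (λ y∉A y∈B → y∉A (B⊆A y∈B)) x∈cl∁

  open-∪ : IsOpen V → IsOpen W → IsOpen (V ∪ W)
  open-∪ {V} {W} V-open W-open = open-resp-≐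
    ((λ { (lift true , y∈V) → inj₁ y∈V ; (lift false , y∈W) → inj₂ y∈W }) ,
     λ { (inj₁ y∈V) → lift true , y∈V ; (inj₂ y∈W) → lift false , y∈W })
    (open-⋃ (Lift ℓ Bool) (λ (lift b) → if b then V else W)
      λ { (lift true) → V-open ; (lift false) → W-open })

  open-∅ : IsOpen (λ _ → Polymorphic.⊥)
  open-∅ = open-resp-≐ ((λ ()) , λ ()) (open-⋃ Polymorphic.⊥ (λ ()) λ ())

  ⋖-∪ : ∀ {U} → _⋖_ K V U → _⋖_ K W U → _⋖_ K (V ∪ W) U
  ⋖-∪ {V} {W} {U} V⋖U W⋖U {x} x∈cl with em {P = x ∈ U}
  ... | yes x∈U = x∈U
  ... | no  x∉U with interior-∩ (∉closure⇒interior (λ x∈clV → x∉U (V⋖U x∈clV)))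
                                (∉closure⇒interior (λ x∈clW → x∉U (W⋖U x∈clW)))
  ...   | G , G-open , x∈G , G⊆ with x∈cl G G-open x∈G
  ...     | y , y∈G , inj₁ y∈V = ⊥-elim (proj₁ (G⊆ y∈G) y∈V)
  ...     | y , y∈G , inj₂ y∈W = ⊥-elim (proj₂ (G⊆ y∈G) y∈W)

  -- The predicate `P` selects the listed sets that enter the union: those meeting `V` in `⋖-dense`,
  -- and those strictly below `V k` in `below`.
  finite-⋃-⋖ : ∀ {j} {J : Set j} {P : Pred J p} (V : J → Pred Point ℓ) {W} →
    (∀ i → P i → IsOpen (V i) × _⋖_ K (V i) W) → (is : List J) →
    ∃ λ C → IsOpen C × _⋖_ K C W × (∀ x → Any (λ i → P i × x ∈ V i) is → x ∈ C)
  finite-⋃-⋖ V V⋖W [] = (λ _ → Polymorphic.⊥) , open-∅ ,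
    (λ x∈cl → case-empty (x∈cl _ (open-whole {V = λ _ → ⊤} (λ _ → tt)) tt)) , λ x ()
    where
    case-empty : ∀ {a} {A : Set a} → (λ (_ : Point) → ⊤ {ℓ}) ≬ (λ _ → Polymorphic.⊥ {ℓ}) → A
    case-empty ()
  finite-⋃-⋖ {P = P} V V⋖W (i ∷ is) with finite-⋃-⋖ V V⋖W is | em {P = P i}
  ... | C , C-open , C⋖W , ⊆C | no ¬Pi = C , C-open , C⋖W , λ where
    x (here (Pi , _)) → ⊥-elim (¬Pi Pi)
    x (there q)       → ⊆C x q
  ... | C , C-open , C⋖W , ⊆C | yes Pi =
    V i ∪ C , open-∪ (proj₁ (V⋖W i Pi)) C-open , ⋖-∪ (proj₂ (V⋖W i Pi)) C⋖W , λ where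
      x (here (_ , x∈Vi)) → inj₁ x∈Vi
      x (there q)         → inj₂ (⊆C x q)

  module _ (compact : Compact K) (hausdorff : Hausdorff K) where

    -- Intersect the neighbourhoods of `x` that miss the selected `D y`. An open set disjoint from
    -- `V` also misses its closure.
    separate-finite : ∀ (P : Pred Point p) (D : Point → Pred Point ℓ) {x} →
      (∀ y → ¬ P y → IsOpen (D y) × x ∈ interior K (∁ (D y))) → (ys : List Point) →
      ∃ λ V → IsOpen V × x ∈ V ×
        (∀ z → Any (λ y → ¬ P y × z ∈ D y) ys → z ∉ closure K V)
    separate-finite P D {x} sep [] = (λ _ → ⊤) , open-whole (λ _ → tt) , tt , λ z ()
    separate-finite P D {x} sep (y ∷ ys) with separate-finite P D sep ys | em {P = P y}
    ... | V , V-open , x∈V , far | yes Py = V , V-open , x∈V , λ where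
      z (here (¬Py , _)) → ⊥-elim (¬Py Py)
      z (there q)        → far z q
    ... | V , V-open , x∈V , far | no ¬Py with sep y ¬Py
    ...   | D-open , G , G-open , x∈G , G⊆ =
      G ∩ V , open-∩ G-open V-open , (x∈G , x∈V) , λ where
        z (here (_ , z∈D)) z∈cl → let _ , w∈D , w∈G , _ = z∈cl (D y) D-open z∈D in
                                  G⊆ w∈G w∈D
        z (there q)        z∈cl → far z q (closure-mono proj₂ z∈cl)

    -- Points of `W` are covered by `W`, the others by open sets that Hausdorff separation keeps
    -- away from `x`. Finitely many suffice; a neighbourhood of `x` whose closure misses those not
    -- contained in `W` has its closure in `W`.
    regular-space : IsOpen W → x ∈ W → ∃ λ V → IsOpen V × x ∈ V × _⋖_ K V W
    regular-space {W} {x} W-open x∈W =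
      let ys , covers           = compact Point D D-open λ y → y , proj₁ (proj₂ (proj₂ (nbhd y)))
          V , V-open , x∈V , far = separate-finite (λ y → D y ⊆ W) D
            (λ y D⊈W → D-open y , separated y D⊈W) ys
      in V , V-open , x∈V , λ {z} z∈cl → dne λ z∉W →
        far z (Any.map (λ z∈D → (λ D⊆W → z∉W (D⊆W z∈D)) , z∈D) (covers z)) z∈cl
      where
      dne : ∀ {z} → ¬ z ∉ W → z ∈ W
      dne = decidable-stable em
      nbhd : ∀ y → ∃ λ D → IsOpen D × y ∈ D × (D ⊆ W ⊎ x ∈ interior K (∁ D))
      nbhd y with em {P = y ∈ W}
      ... | yes y∈W = W , W-open , y∈W , inj₁ (λ z∈W → z∈W)
      ... | no  y∉W with hausdorff x y (λ x≈y → y∉W (open-resp-≈ W-open x≈y x∈W))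
      ...   | V , D , V-open , D-open , x∈V , y∈D , V⊥D =
        D , D-open , y∈D , inj₂ (V , V-open , x∈V , λ z∈V z∈D → V⊥D (z∈V , z∈D))
      D : Point → Pred Point ℓ
      D y = proj₁ (nbhd y)
      D-open : ∀ y → IsOpen (D y)
      D-open y = proj₁ (proj₂ (nbhd y))
      separated : ∀ y → ¬ D y ⊆ W → x ∈ interior K (∁ (D y))
      separated y D⊈W with proj₂ (proj₂ (proj₂ (nbhd y)))
      ... | inj₁ D⊆W   = ⊥-elim (D⊈W D⊆W)
      ... | inj₂ x∈int = x∈int

    -- This is normality. Points of the closure of `V` get a neighbourhood whose closure lies in
    -- `W`, other points one missing `V`; the members of a finite subcover that meet `V` together
    -- contain its closure.
    ⋖-dense : IsOpen W → _⋖_ K V W → ∃ λ C → IsOpen C × _⋖_ K V C × _⋖_ K C W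
    ⋖-dense {W} {V} W-open V⋖W =
      let ys , covers           = compact Point D D-open λ y → y , proj₁ (proj₂ (proj₂ (nbhd y)))
          C , C-open , C⋖W , ⊆C = finite-⋃-⋖ {P = λ y → ¬ D y ⊆ ∁ V} D
            (λ y D≬V → D-open y , below y D≬V) ys
      in C , C-open , (λ {z} z∈cl → ⊆C z (Any.map
           (λ {y} z∈D → (λ D⊆ → let _ , w∈D , w∈V = z∈cl (D y) (D-open y) z∈D in D⊆ w∈D w∈V)
                        , z∈D)
           (covers z))) , C⋖W
      where
      nbhd : ∀ y → ∃ λ D → IsOpen D × y ∈ D × (_⋖_ K D W ⊎ D ⊆ ∁ V)
      nbhd y with em {P = y ∈ closure K V}
      ... | yes y∈cl = let D , D-open , y∈D , D⋖W = regular-space W-open (V⋖W y∈cl) in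
                       D , D-open , y∈D , inj₁ D⋖W
      ... | no  y∉cl = let D , D-open , y∈D , D⊆ = ∉closure⇒interior y∉cl in
                       D , D-open , y∈D , inj₂ D⊆
      D : Point → Pred Point ℓ
      D y = proj₁ (nbhd y)
      D-open : ∀ y → IsOpen (D y)
      D-open y = proj₁ (proj₂ (nbhd y))
      below : ∀ y → ¬ D y ⊆ ∁ V → _⋖_ K (D y) W
      below y D≬V with proj₂ (proj₂ (proj₂ (nbhd y)))
      ... | inj₁ D⋖W = D⋖W
      ... | inj₂ D⊆  = ⊥-elim (D≬V D⊆)

-- Limits of sequences with geometrically decreasing steps.

module GeometricSequences (em : ∀ {a} → ExcludedMiddle a) (ℝ : CompleteOrderedField) where

  open Real ℝ
  open SupNorm em ℝ using (sup; ≤+ε⇒≤)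
  open IntegerCoefficients commutativeRing
  open Func using (to)

  ½ : Carrier
  ½ = proj₁ (half 0<1)

  0<½ : 0# < ½
  0<½ = proj₁ (proj₂ (half 0<1))

  ½+½≈1 : ½ + ½ ≈ 1#
  ½+½≈1 = proj₂ (proj₂ (half 0<1))

  ½x+½x≈x : ∀ x → ½ * x + ½ * x ≈ x
  ½x+½x≈x x = trans (sym (distribʳ x ½ ½)) (trans (*-congʳ ½+½≈1) (*-identityˡ x))

  ½[x+x]≈x : ∀ x → ½ * (x + x) ≈ x
  ½[x+x]≈x x = trans (distribˡ ½ x x) (½x+½x≈x x)

  0<½x : ∀ {x} → 0# < x → 0# < ½ * x
  0<½x {x} 0<x = *-nonneg (proj₁ 0<½) (proj₁ 0<x) , λ q → proj₂ 0<x
    (trans (sym (+-identityˡ 0#)) (trans (+-cong q q) (½x+½x≈x x)))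

  ½x≤x : ∀ {x} → 0# ≤ x → ½ * x ≤ x
  ½x≤x {x} 0≤x = ≤-resp refl (½x+½x≈x x) (x≤x+nonneg (*-nonneg (proj₁ 0<½) 0≤x))

  dist≤⇒≤+ : ∀ {x y z} → ∣ x + - y ∣ ≤ z → x ≤ z + y
  dist≤⇒≤+ d = x-y≤z⇒x≤z+y (≤-trans (x≤∣x∣ _) d)

  ≤+⇒dist≤ : ∀ {x y z} → x ≤ z + y → y ≤ z + x → ∣ x + - y ∣ ≤ z
  ≤+⇒dist≤ {x} {y} p q = ∣∣-lub (x≤z+y⇒x-y≤z p)
    (≤-resp (sym (neg-sub x y)) refl (x≤z+y⇒x-y≤z q))

  geometric : Carrier → ℕ → Carrier
  geometric ρ zero      = ρ
  geometric ρ (ℕ.suc n) = ½ * geometric ρ n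

  module _ {ρ} (0≤ρ : 0# ≤ ρ) where

    geometric-nonneg : ∀ n → 0# ≤ geometric ρ n
    geometric-nonneg zero      = 0≤ρ
    geometric-nonneg (ℕ.suc n) = *-nonneg (proj₁ 0<½) (geometric-nonneg n)

    geometric-positive : 0# < ρ → ∀ n → 0# < geometric ρ n
    geometric-positive 0<ρ zero      = 0<ρ
    geometric-positive 0<ρ (ℕ.suc n) = 0<½x (geometric-positive 0<ρ n)

    -- If every term exceeded `ε`, the lower bounds of the sequence would have a supremum `s ≥ ε`.
    -- Doubling a lower bound gives a lower bound, so `s ≤ ½ * s` and thus `s ≤ 0`.
    geometric-small : ∀ ε → 0# < ε → ∃ λ n → geometric ρ n ≤ ε
    geometric-small ε 0<ε = decidable-stable em λ large →
      let Below r = ∀ n → r ≤ geometric ρ n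
          ε-below : Below ε
          ε-below n = [ (λ q → q) , (λ q → ⊥-elim (large (n , q))) ]′ (O.total ε _)
          s , upper , least = sup Below (ε , ε-below) (ρ , λ r below → below 0)
          s≤½s : s ≤ ½ * s
          s≤½s = least (½ * s) λ r below → ≤-resp (½[x+x]≈x r) refl
            (*-monoˡ-≤ (proj₁ 0<½) (upper (r + r) λ n →
              ≤-resp refl (½x+½x≈x _) (+-mono-≤ (below (ℕ.suc n)) (below (ℕ.suc n)))))
          ½s≤0 : ½ * s ≤ 0#
          ½s≤0 = +-cancelʳ-≤ (½ * s)
            (≤-resp (sym (½x+½x≈x s)) (sym (+-identityˡ _)) s≤½s)
      in <⇒≱ 0<ε (≤-trans (upper ε ε-below) (≤-trans s≤½s ½s≤0))

    module _ (a : ℕ → Carrier)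
      (step : ∀ n → ∣ a (ℕ.suc n) + - a n ∣ ≤ geometric ρ n) where

      private
        -- The steps from `n` on add up to at most `g n + g n`, so the intervals from `lower n` to
        -- `upper n` are nested and the limit lies in all of them.
        g lower upper : ℕ → Carrier
        g         = geometric ρ
        lower n   = a n + - (g n + g n)
        upper n   = a n + (g n + g n)

      lower-step : ∀ n → lower n ≤ lower (ℕ.suc n)
      lower-step n = ≤-resp refl
        (trans
          (solve 2 (λ b g → g :+ b :+ :- (g :+ g) := b :+ :- g) refl (a (ℕ.suc n)) (g n))
          (+-congˡ (-‿cong (sym (½x+½x≈x (g n))))))
        (+-monoˡ-≤ (- (g n + g n)) (dist≤⇒≤+
          (≤-resp (∣sub∣-comm (a (ℕ.suc n)) (a n)) refl (step n))))

      upper-step : ∀ n → upper (ℕ.suc n) ≤ upper n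
      upper-step n = ≤-resp
        (+-congˡ (sym (½x+½x≈x (g n))))
        (solve 2 (λ a g → g :+ a :+ g := a :+ (g :+ g)) refl (a n) (g n))
        (+-monoˡ-≤ (g n) (dist≤⇒≤+ (step n)))

      lower-mono : ∀ n k → lower n ≤ lower (k ℕ.+ n)
      lower-mono n zero      = ≤-refl
      lower-mono n (ℕ.suc k) = ≤-trans (lower-mono n k) (lower-step (k ℕ.+ n))

      upper-mono : ∀ n k → upper (k ℕ.+ n) ≤ upper n
      upper-mono n zero      = ≤-refl
      upper-mono n (ℕ.suc k) = ≤-trans (upper-step (k ℕ.+ n)) (upper-mono n k)

      lower≤upper : ∀ m n → lower m ≤ upper n
      lower≤upper m n = ≤-trans (lower-mono m n) (≤-trans
        (≤-resp refl (reflexive (≡.cong upper (ℕ.+-comm n m))) (same (n ℕ.+ m)))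
        (upper-mono n m))
        where
        same : ∀ k → lower k ≤ upper k
        same k = ≤-trans (x≤x+nonneg (+-nonneg (+-nonneg 0≤g 0≤g) (+-nonneg 0≤g 0≤g)))
          (≤-resp refl
            (solve 2 (λ a g → a :+ :- (g :+ g) :+ ((g :+ g) :+ (g :+ g)) := a :+ (g :+ g))
              refl (a k) (g k)) ≤-refl)
          where
          0≤g : 0# ≤ g k
          0≤g = geometric-nonneg k
          +-nonneg : ∀ {x y} → 0# ≤ x → 0# ≤ y → 0# ≤ x + y
          +-nonneg p q = ≤-trans p (x≤x+nonneg q)

      limit : ∃ (IsSupremum λ r → ∃ λ n → r ≤ a n + - (geometric ρ n + geometric ρ n))
      limit = sup _ (lower 0 , 0 , ≤-refl) (upper 0 , λ r (n , r≤) → ≤-trans r≤ (lower≤upper n 0))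

      limit-close : ∀ n → ∣ proj₁ limit + - a n ∣ ≤ g n + g n
      limit-close n = ≤+⇒dist≤
        (≤-resp refl (+-comm _ _)
          (proj₂ (proj₂ limit) (upper n) λ r (m , r≤) → ≤-trans r≤ (lower≤upper m n)))
        (≤-resp refl (+-comm _ _) (x-y≤z⇒x≤z+y (proj₁ (proj₂ limit) (lower n) (n , ≤-refl))))

    2geometric-small : ∀ ε → 0# < ε → ∃ λ n → geometric ρ n + geometric ρ n ≤ ε
    2geometric-small ε 0<ε = let n , small = geometric-small ε 0<ε in
      ℕ.suc n , ≤-trans (≈⇒≤ (½x+½x≈x _)) small

  -- Turns estimates into equations: limit functions respect the setoid equality, and a sequence
  -- constant at a point has that constant as its limit.
  approximations-unique : ∀ {x y} →
    (∀ ε → 0# < ε → ∃ λ z → ∣ x + - z ∣ ≤ ε × ∣ y + - z ∣ ≤ ε) → x ≈ y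
  approximations-unique approx =
    O.antisym (below approx) (below λ ε 0<ε →
      let z , d , d′ = approx ε 0<ε in z , d′ , d)
    where
    below : ∀ {x y} → (∀ ε → 0# < ε → ∃ λ z → ∣ x + - z ∣ ≤ ε × ∣ y + - z ∣ ≤ ε) → x ≤ y
    below {x} {y} approx = ≤+ε⇒≤ λ ε 0<ε →
      let δ , 0<δ , δ+δ≈ε = half 0<ε
          z , d , d′ = approx δ 0<δ
      in ≤-trans (dist≤⇒≤+ d) (≤-resp refl
           (trans (sym (+-assoc δ δ y)) (trans (+-congʳ δ+δ≈ε) (+-comm ε y)))
           (+-mono-≤ (≤-refl {δ}) (dist≤⇒≤+ (≤-resp (∣sub∣-comm y z) refl d′))))

  module _ {i e} (X : Setoid i e) {ρ} (0≤ρ : 0# ≤ ρ) (f : ℕ → Func X setoid)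
    (step : ∀ n x → ∣ to (f (ℕ.suc n)) x + - to (f n) x ∣ ≤ geometric ρ n) where

    uniformLimit : ∃ λ (F : Func X setoid) →
      ∀ n x → ∣ to F x + - to (f n) x ∣ ≤ geometric ρ n + geometric ρ n
    uniformLimit = record { to = λ x → proj₁ (lim x) ; cong = lim-cong } ,
      λ n x → limit-close 0≤ρ (λ n → to (f n) x) (λ n → step n x) n
      where
      lim : ∀ x → _
      lim x = limit 0≤ρ (λ n → to (f n) x) (λ n → step n x)
      lim-cong : ∀ {x y} → Setoid._≈_ X x y → proj₁ (lim x) ≈ proj₁ (lim y)
      lim-cong {x} {y} x≈y = approximations-unique λ ε 0<ε →
        let n , small = 2geometric-small 0≤ρ ε 0<ε in to (f n) x ,
          ≤-trans (limit-close 0≤ρ _ (λ n → step n x) n) small ,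
          ≤-trans (≤-resp (∣∣-cong (+-congˡ (-‿cong (Func.cong (f n) (Setoid.sym X x≈y))))) refl
            (limit-close 0≤ρ _ (λ n → step n y) n)) small

-- Urysohn's lemma.

module Urysohn (em : ∀ {a} → ExcludedMiddle a) (ℝ : CompleteOrderedField)
  {ℓ} (K : TopologicalSpace ℓ) (compact : Compact K) (hausdorff : Hausdorff K) where

  open Real ℝ
  open SupNorm em ℝ using (Continuous)
  open TopologicalSpace K
  open Topology em K
  open GeometricSequences em ℝ
  open IntegerCoefficients commutativeRing
  open Func using (to)

  indicator : ∀ {a} {A : Set a} → Dec A → Carrier
  indicator (yes _) = 1#
  indicator (no _)  = 0#

  indicator-yes : ∀ {a} {A : Set a} (d : Dec A) → A → indicator d ≈ 1#
  indicator-yes (yes _) _ = refl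
  indicator-yes (no ¬a) a = ⊥-elim (¬a a)

  indicator-no : ∀ {a} {A : Set a} (d : Dec A) → ¬ A → indicator d ≈ 0#
  indicator-no (yes a) ¬a = ⊥-elim (¬a a)
  indicator-no (no _)  _  = refl

  indicator-cong : ∀ {a b} {A : Set a} {B : Set b} (d : Dec A) (d′ : Dec B) →
    (A → B) → (B → A) → indicator d ≈ indicator d′
  indicator-cong (yes a) d′ f g = sym (indicator-yes d′ (f a))
  indicator-cong (no ¬a) d′ f g = sym (indicator-no d′ λ b → ¬a (g b))

  0≤indicator : ∀ {a} {A : Set a} (d : Dec A) → 0# ≤ indicator d
  0≤indicator (yes _) = 0≤1
  0≤indicator (no _)  = ≤-refl

  indicator≤1 : ∀ {a} {A : Set a} (d : Dec A) → indicator d ≤ 1#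
  indicator≤1 (yes _) = ≤-refl
  indicator≤1 (no _)  = 0≤1

  ∣indicator-indicator∣≤1 : ∀ {a b} {A : Set a} {B : Set b} (d : Dec A) (d′ : Dec B) →
    ∣ indicator d + - indicator d′ ∣ ≤ 1#
  ∣indicator-indicator∣≤1 d d′ = ≤+⇒dist≤
    (≤-trans (indicator≤1 d) (x≤x+nonneg (0≤indicator d′)))
    (≤-trans (indicator≤1 d′) (x≤x+nonneg (0≤indicator d)))

  -- The data that the construction carries along: `between` inserts an open set and so splits a gap
  -- into two gaps.
  record Gap : Set (suc ℓ) where
    field
      inner outer : Pred Point ℓ
      outer-open  : IsOpen outer
      inner⋖outer : _⋖_ K inner outer

    between : ∃ λ C → IsOpen C × _⋖_ K inner C × _⋖_ K C outer
    between = ⋖-dense compact hausdorff outer-open inner⋖outer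

  open Gap

  innerHalf outerHalf : Gap → Gap
  innerHalf g = let C , C-open , V⋖C , _ = between g in
    record { inner = inner g ; outer = C ; outer-open = C-open ; inner⋖outer = V⋖C }
  outerHalf g = let C , _ , _ , C⋖W = between g in
    record { inner = C ; outer = outer g ; outer-open = outer-open g ; inner⋖outer = C⋖W }

  -- After `n` splittings there are `2ⁿ` gaps; the value is the mean of the indicators of their
  -- outer sets, a dyadic step function.
  staircase : ℕ → Gap → Point → Carrier
  staircase zero      g x = indicator (em {P = x ∈ outer g})
  staircase (ℕ.suc n) g x = ½ * (staircase n (innerHalf g) x + staircase n (outerHalf g) x)

  ½-cong : ∀ {a a′ b b′} → a ≈ a′ → b ≈ b′ → ½ * (a + b) ≈ ½ * (a′ + b′)
  ½-cong p q = *-congˡ (+-cong p q)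

  -- Only one of the averaged terms varies, so the variation is halved; this is the source of the
  -- geometric rate below.
  ½-distˡ : ∀ {a a′ b b′ r} → ∣ a + - a′ ∣ ≤ r → b ≈ b′ →
    ∣ ½ * (a + b) + - (½ * (a′ + b′)) ∣ ≤ ½ * r
  ½-distˡ {a} {a′} {b} {b′} {r} d b≈b′ = ≤-resp
    (sym (begin
      ∣ ½ * (a + b) + - (½ * (a′ + b′)) ∣ ≈⟨ ∣∣-cong (+-congʳ (*-congˡ (+-congˡ b≈b′))) ⟩
      ∣ ½ * (a + b′) + - (½ * (a′ + b′)) ∣
        ≈⟨ ∣∣-cong (solve 4 (λ h a a′ b → h :* (a :+ b) :+ :- (h :* (a′ :+ b))
                     := h :* (a :+ :- a′)) refl ½ a a′ b′) ⟩
      ∣ ½ * (a + - a′) ∣                  ≈⟨ ∣∣-* ½ _ ⟩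
      ∣ ½ ∣ * ∣ a + - a′ ∣                ≈⟨ *-congʳ (nonneg⇒∣∣ (proj₁ 0<½)) ⟩
      ½ * ∣ a + - a′ ∣                    ∎)) refl
    (*-monoˡ-≤ (proj₁ 0<½) d)
    where open import Relation.Binary.Reasoning.Setoid setoid

  ½-distʳ : ∀ {a a′ b b′ r} → a ≈ a′ → ∣ b + - b′ ∣ ≤ r →
    ∣ ½ * (a + b) + - (½ * (a′ + b′)) ∣ ≤ ½ * r
  ½-distʳ p d = ≤-resp
    (∣∣-cong (+-cong (*-congˡ (+-comm _ _)) (-‿cong (*-congˡ (+-comm _ _))))) refl
    (½-distˡ d p)

  staircase-cong : ∀ n g {x y} → x ≈ₚ y → staircase n g x ≈ staircase n g y
  staircase-cong zero      g x≈y = indicator-cong em em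
    (open-resp-≈ (outer-open g) x≈y)
    (open-resp-≈ (outer-open g) (Setoid.sym points x≈y))
  staircase-cong (ℕ.suc n) g x≈y =
    ½-cong (staircase-cong n (innerHalf g) x≈y) (staircase-cong n (outerHalf g) x≈y)

  staircase-outer : ∀ n g {x} → x ∉ outer g → staircase n g x ≈ 0#
  staircase-outer zero      g x∉ = indicator-no em x∉
  staircase-outer (ℕ.suc n) g x∉ = trans
    (½-cong (staircase-outer n (innerHalf g) λ x∈C → x∉ (inner⋖outer (outerHalf g) (⊆closure x∈C)))
            (staircase-outer n (outerHalf g) x∉))
    (trans (*-congˡ (+-identityˡ 0#)) (zeroʳ ½))

  staircase-inner : ∀ n g {x} → x ∈ closure K (inner g) →
    x ∈ interior K (λ y → staircase n g y ≈ 1#)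
  staircase-inner zero      g x∈cl = interior-mono (λ y∈W → indicator-yes em y∈W)
    (open⇒interior (outer-open g) (inner⋖outer g x∈cl))
  staircase-inner (ℕ.suc n) g x∈cl = interior-mono
    (λ (p , q) → trans (½-cong p q) (½[x+x]≈x 1#))
    (interior-∩ (staircase-inner n (innerHalf g) x∈cl)
                (staircase-inner n (outerHalf g) (⊆closure (inner⋖outer (innerHalf g) x∈cl))))

  -- Let `C` be the inserted set. Near a point of its closure the outer half is constantly 1, and
  -- near any other point the inner half is constantly 0, so only one half oscillates.
  staircase-osc : ∀ n g x → x ∈ interior K λ y →
    ∣ staircase n g y + - staircase n g x ∣ ≤ geometric 1# n
  staircase-osc zero      g x = universal⇒interior (λ y → ∣indicator-indicator∣≤1 em em) x
  staircase-osc (ℕ.suc n) g x with em {P = x ∈ closure K (inner (outerHalf g))}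
  ... | yes x∈cl = interior-mono
    (λ (d , p) → ½-distˡ d (trans p (sym (interior-⊆ one))))
    (interior-∩ (staircase-osc n (innerHalf g) x) one)
    where one = staircase-inner n (outerHalf g) x∈cl
  ... | no x∉cl = interior-mono
    (λ (d , y∉C) → ½-distʳ (trans (staircase-outer n (innerHalf g) y∉C)
                              (sym (staircase-outer n (innerHalf g) λ x∈C → x∉cl (⊆closure x∈C)))) d)
    (interior-∩ (staircase-osc n (outerHalf g) x) (∉closure⇒interior x∉cl))

  staircase-step : ∀ n g x →
    ∣ staircase (ℕ.suc n) g x + - staircase n g x ∣ ≤ geometric 1# n
  -- `g` and its outer half have the same outer set, so stage 0 is the mean of two copies of itself
  -- and only the inner half differs.
  staircase-step zero      g x = ≤-trans
    (≤-resp (∣∣-cong (+-congˡ (-‿cong (½[x+x]≈x _)))) (*-identityʳ ½)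
      (½-distˡ (∣indicator-indicator∣≤1 em em) refl))
    (≤-resp refl ½+½≈1 (x≤x+nonneg (proj₁ 0<½)))
  staircase-step (ℕ.suc n) g x with em {P = x ∈ inner (outerHalf g)}
  ... | yes x∈C = ½-distˡ (staircase-step n (innerHalf g) x)
    (trans (interior-⊆ (staircase-inner (ℕ.suc n) (outerHalf g) (⊆closure x∈C)))
      (sym (interior-⊆ (staircase-inner n (outerHalf g) (⊆closure x∈C)))))
  ... | no x∉C  = ½-distʳ
    (trans (staircase-outer (ℕ.suc n) (innerHalf g) x∉C)
      (sym (staircase-outer n (innerHalf g) x∉C)))
    (staircase-step n (outerHalf g) x)

  -- The last clause is the error estimate at stage 0, where the staircase is the indicator of the
  -- outer set; the bound on the bumps comes from it.
  urysohn : (g : Gap) → ∃ λ f → Continuous K f ×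
    (∀ x → x ∈ inner g → to f x ≈ 1#) × (∀ x → x ∉ outer g → to f x ≈ 0#) ×
    (∀ x → ∣ to f x + - staircase 0 g x ∣ ≤ 1# + 1#)
  urysohn g = f , continuous ,
    (λ x x∈V → constant λ n → interior-⊆ (staircase-inner n g (⊆closure x∈V))) ,
    (λ x x∉W → constant λ n → staircase-outer n g x∉W) ,
    close 0
    where
    u : ℕ → Func points setoid
    u n = record { to = staircase n g ; cong = staircase-cong n g }
    f : Func points setoid
    f = proj₁ (uniformLimit points 0≤1 u λ n → staircase-step n g)
    close : ∀ n x → ∣ to f x + - staircase n g x ∣ ≤ geometric 1# n + geometric 1# n
    close = proj₂ (uniformLimit points 0≤1 u λ n → staircase-step n g)
    constant : ∀ {x c} → (∀ n → staircase n g x ≈ c) → to f x ≈ c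
    constant {x} {c} u≈c = approximations-unique λ ε 0<ε →
      let n , small = 2geometric-small 0≤1 ε 0<ε in c ,
      ≤-trans (≤-resp (∣∣-cong (+-congˡ (-‿cong (u≈c n)))) refl (close n x)) small ,
      ≤-trans (≈⇒≤ (trans (∣∣-cong (-‿inverseʳ c)) ∣0∣)) (proj₁ 0<ε)
    continuous : Continuous K f
    continuous x ε 0<ε =
      -- With `η` a quarter of `ε`, two approximation errors and one oscillation sum to at most
      -- `3η`, which is below `ε`.
      let δ , 0<δ , δ+δ≈ε = half 0<ε
          η , 0<η , η+η≈δ = half 0<δ
          n , small = 2geometric-small 0≤1 η 0<η
          gn≤η = ≤-trans (x≤x+nonneg (geometric-nonneg 0≤1 n)) small
          V , V-open , x∈V , osc = staircase-osc n g x
      in V , V-open , x∈V , λ y y∈V → ≤-<-trans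
        (≤-trans (∣sub∣-trans (to f y) (staircase n g y) (to f x))
          (+-mono-≤ (≤-trans (close n y) small)
            (≤-trans (∣sub∣-trans (staircase n g y) (staircase n g x) (to f x))
              (+-mono-≤ (≤-trans (osc y∈V) gn≤η)
                (≤-resp (∣sub∣-comm _ _) refl (≤-trans (close n x) small))))))
        (<-≤-trans (+-monoˡ-< (η + η) (half<whole 0<η η+η≈δ))
          (≈⇒≤ (trans (+-congˡ η+η≈δ) δ+δ≈ε)))

-- The space of functions with prescribed jumps.

module JumpSpace (em : ∀ {a} → ExcludedMiddle a) (ℝ : CompleteOrderedField)
  {ℓ i e} (K : TopologicalSpace ℓ) (compact : Compact K)
  (κ : Setoid i e) (V : Setoid.Carrier κ → Pred (TopologicalSpace.Point K) ℓ) where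

  open Real ℝ
  open SupNorm em ℝ
  open TopologicalSpace K
  open Topology em K
  open IntegerCoefficients commutativeRing
  open Func using (to; cong)

  private
    module κ = Setoid κ
    module C = FunctionSpace (continuousFunctions K compact)
    module c₀ = FunctionSpace (vanishingFunctions κ)

  Jumps : Point → Point → Set (suc ℓ ⊔ i)
  Jumps x y = ∃ λ k → x ∈ ∂ K (V k) × y ∈ V k

  jumpOf : ∀ {x y} → Dec (Jumps x y) → (κ.Carrier → Carrier) → Carrier
  jumpOf (yes (k , _)) c = c k
  jumpOf (no _)        c = 0#

  -- The boundaries of a chain are disjoint, so at most one k jumps between x and y.
  jump : (κ.Carrier → Carrier) → Point → Point → Carrier
  jump c x y = jumpOf {x} {y} em c

  module _ {x y : Point} where

    jumpOf-zero : ∀ (d : Dec (Jumps x y)) {c} →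
      (∀ k → x ∈ ∂ K (V k) → y ∈ V k → c k ≈ 0#) → jumpOf d c ≈ 0#
    jumpOf-zero (yes (k , x∈∂ , y∈V)) c≈0 = c≈0 k x∈∂ y∈V
    jumpOf-zero (no _)                c≈0 = refl

    jumpOf-eval : ∀ (d : Dec (Jumps x y)) {c k} → x ∈ ∂ K (V k) → y ∈ V k →
      (∀ j → x ∈ ∂ K (V j) → c j ≈ c k) → jumpOf d c ≈ c k
    jumpOf-eval (yes (j , x∈∂j , _)) x∈∂ y∈V unique = unique j x∈∂j
    jumpOf-eval (no ¬jump)           x∈∂ y∈V unique = ⊥-elim (¬jump (_ , x∈∂ , y∈V))

    jumpOf-cong : ∀ (d : Dec (Jumps x y)) {c c′} → (∀ k → c k ≈ c′ k) → jumpOf d c ≈ jumpOf d c′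
    jumpOf-cong (yes (k , _)) q = q k
    jumpOf-cong (no _)        q = refl

    jumpOf-+ : ∀ (d : Dec (Jumps x y)) c c′ →
      jumpOf d (λ k → c k + c′ k) ≈ jumpOf d c + jumpOf d c′
    jumpOf-+ (yes _) c c′ = refl
    jumpOf-+ (no _)  c c′ = sym (+-identityˡ 0#)

    jumpOf-* : ∀ (d : Dec (Jumps x y)) a c → jumpOf d (λ k → a * c k) ≈ a * jumpOf d c
    jumpOf-* (yes _) a c = refl
    jumpOf-* (no _)  a c = sym (zeroʳ a)

    jumpOf-bound : ∀ (d : Dec (Jumps x y)) {c η} → 0# ≤ η → (∀ k → ∣ c k ∣ ≤ η) →
      ∣ jumpOf d c ∣ ≤ η
    jumpOf-bound (yes (k , _)) 0≤η b = b k
    jumpOf-bound (no _)        0≤η b = ≤-trans (≈⇒≤ ∣0∣) 0≤η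

  -- A function on `K` paired with its jumps is encoded as one function on the disjoint union, so
  -- that norm and completeness come from `FunctionSpace`.
  domain : Setoid _ _
  domain = ⊎-setoid points κ

  atPoints : Fun domain → Fun points
  atPoints f = record { to = λ x → to f (inj₁ x) ; cong = λ q → cong f (Pointwise.inj₁ q) }

  coefficients : Fun domain → Fun κ
  coefficients f = record { to = λ k → to f (inj₂ k) ; cong = λ q → cong f (Pointwise.inj₂ q) }

  -- Having the prescribed jumps at `x` means that this is small for `y` near `x`. It is linear in
  -- `f`, so closure under the operations goes as for continuity.
  deviation : Fun domain → Point → Point → Carrier
  deviation f x y =
    (to f (inj₁ y) + - to f (inj₁ x)) + - jump (to (coefficients f)) x y

  deviation-cong : ∀ f g → (∀ p → to f p ≈ to g p) → ∀ x y → deviation f x y ≈ deviation g x y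
  deviation-cong f g q x y = +-cong (+-cong (q (inj₁ y)) (-‿cong (q (inj₁ x))))
    (-‿cong (jumpOf-cong em λ k → q (inj₂ k)))

  deviation-+ : ∀ f g x y → deviation (addᶠ domain f g) x y ≈ deviation f x y + deviation g x y
  deviation-+ f g x y = trans (+-congˡ (-‿cong (jumpOf-+ em _ _)))
    (solve 6 (λ a b c d e f → ((a :+ b) :+ :- (c :+ d)) :+ :- (e :+ f)
       := ((a :+ :- c) :+ :- e) :+ ((b :+ :- d) :+ :- f)) refl _ _ _ _ _ _)

  deviation-* : ∀ a f x y → deviation (scaleᶠ domain a f) x y ≈ a * deviation f x y
  deviation-* a f x y = trans (+-congˡ (-‿cong (jumpOf-* em a _)))
    (solve 4 (λ a b c d → (a :* b :+ :- (a :* c)) :+ :- (a :* d)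
       := a :* ((b :+ :- c) :+ :- d)) refl a _ _ _)

  deviation-bound : ∀ f {η} → 0# ≤ η → (∀ p → ∣ to f p ∣ ≤ η) →
    ∀ x y → ∣ deviation f x y ∣ ≤ (η + η) + η
  deviation-bound f 0≤η b x y = ≤-trans (∣∣-triangle _ _)
    (+-mono-≤ (≤-trans (∣∣-triangle _ _)
                (+-mono-≤ (b (inj₁ y)) (≤-resp (sym (∣-x∣ _)) refl (b (inj₁ x)))))
      (≤-resp (sym (∣-x∣ _)) refl (jumpOf-bound em 0≤η λ k → b (inj₂ k))))

  Bounded : Pred (Fun domain) (ℓ ⊔ i)
  Bounded f = ∃ λ B → ∀ p → ∣ to f p ∣ ≤ B

  JumpsByCoefficients : Pred (Fun domain) (suc ℓ)
  JumpsByCoefficients f = ∀ x ε → 0# < ε → x ∈ interior K (λ y → ∣ deviation f x y ∣ < ε)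

  -- A function with coefficients c is continuous at x off all boundaries, and near
  -- x ∈ ∂ (V k) it becomes continuous at x after subtracting c k on V k.
  jumpFunctions : FunctionSpace domain (suc ℓ ⊔ i ⊔ e)
  jumpFunctions = record
    { Member       = λ f → Bounded f × Vanishing κ (coefficients f) × JumpsByCoefficients f
    ; member⇒bdd   = λ f f∈ → proj₁ f∈
    ; zero-closed  = (0# , λ p → ≈⇒≤ ∣0∣) , c₀.zero-closed , λ x ε 0<ε →
        universal⇒interior (λ y → ≤-<-trans (≈⇒≤ (trans (∣∣-cong (trans
          (+-cong (-‿inverseʳ 0#) (trans (-‿cong (jumpOf-zero em λ _ _ _ → refl)) -0#≈0#))
          (+-identityˡ 0#))) ∣0∣)) 0<ε) x
    ; add-closed   = λ f g ((B , b) , vf , jf) ((B′ , b′) , vg , jg) →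
        (B + B′ , λ p → ≤-trans (∣∣-triangle _ _) (+-mono-≤ (b p) (b′ p))) ,
        c₀.add-closed (coefficients f) (coefficients g) vf vg , add f g jf jg
    ; scale-closed = λ a f ((B , b) , vf , jf) →
        (∣ a ∣ * B , λ p → ≤-resp (sym (∣∣-* a _)) refl (*-monoˡ-≤ (∣∣-nonneg a) (b p))) ,
        c₀.scale-closed a (coefficients f) vf , scale a f jf
    ; limit-closed = λ f approx →
        (let g , ((B , b) , _) , close = approx 1# 0<1 in
         1# + B , λ p → ≤-trans (∣x∣≤∣x-y∣+∣y∣ (close p)) (+-mono-≤ ≤-refl (b p))) ,
        c₀.limit-closed (coefficients f) (λ ε 0<ε →
          let g , (_ , vg , _) , close = approx ε 0<ε in coefficients g , vg , λ k → close (inj₂ k)) ,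
        closed f λ ε 0<ε → let g , (_ , _ , jg) , close = approx ε 0<ε in g , jg , close
    }
    where
    add : ∀ f g → JumpsByCoefficients f → JumpsByCoefficients g →
      JumpsByCoefficients (addᶠ domain f g)
    add f g jf jg x ε 0<ε = let δ , 0<δ , δ+δ≈ε = half 0<ε in interior-mono
      (λ {y} (df , dg) → ≤-<-trans
        (≤-resp (∣∣-cong (sym (deviation-+ f g x y))) refl (∣∣-triangle _ _))
        (<-≤-trans (+-mono-< df dg) (≈⇒≤ δ+δ≈ε)))
      (interior-∩ (jf x δ 0<δ) (jg x δ 0<δ))

    scale : ∀ a f → JumpsByCoefficients f → JumpsByCoefficients (scaleᶠ domain a f)
    scale a f jf x ε 0<ε = let δ , 0<δ , ∣a∣δ<ε = scaled a 0<ε in interior-mono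
      (λ {y} df → ≤-<-trans
        (≤-resp (sym (trans (∣∣-cong (deviation-* a f x y)) (∣∣-* a _))) refl
          (*-monoˡ-≤ (∣∣-nonneg a) (proj₁ df))) ∣a∣δ<ε)
      (jf x δ 0<δ)

    closed : ∀ f → (∀ ε → 0# < ε → ∃ λ g → JumpsByCoefficients g ×
      (∀ p → ∣ to f p + - to g p ∣ ≤ ε)) → JumpsByCoefficients f
    closed f approx x ε 0<ε =
      -- `η` is an eighth of `ε`: since `f-g` is bounded by `η`, its deviation is at most `3η`,
      -- hence at most `δ`.
      let δ , 0<δ , δ+δ≈ε = half 0<ε
          θ , 0<θ , θ+θ≈δ = half 0<δ
          η , 0<η , η+η≈θ = half 0<θ
          g , jg , close = approx η 0<η
          f-g = addᶠ domain f (negᶠ domain g)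
          f-g-small : ∀ y → ∣ deviation f-g x y ∣ ≤ δ
          f-g-small y = ≤-trans (deviation-bound f-g (proj₁ 0<η) close x y)
            (≤-resp refl θ+θ≈δ (+-mono-≤ (≈⇒≤ η+η≈θ) (proj₁ (half<whole 0<η η+η≈θ))))
      in interior-mono
        (λ {y} dg → ≤-<-trans
          (≤-resp (∣∣-cong (trans (sym (deviation-+ f-g g x y))
              (deviation-cong (addᶠ domain f-g g) f (λ p → x-y+y (to f p) (to g p)) x y)))
            refl (∣∣-triangle _ _))
          (<-≤-trans (≤-<-trans (+-mono-≤ (f-g-small y) ≤-refl) (+-monoʳ-< δ dg))
            (≈⇒≤ δ+δ≈ε)))
        (jg x δ 0<δ)

  Z : BanachSpace ℝ (suc ℓ ⊔ i ⊔ e) (ℓ ⊔ i)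
  Z = FunctionSpace.banachSpace jumpFunctions

  private module Z = FunctionSpace jumpFunctions

  extendByZero : Fun points → Fun domain
  extendByZero g = record
    { to   = [ to g , (λ _ → 0#) ]′
    ; cong = λ { (Pointwise.inj₁ q) → cong g q ; (Pointwise.inj₂ q) → refl }
    }

  -- Without jumps, membership in `Z` is ordinary continuity, which identifies the kernel of `π`
  -- with `C(K)`.
  deviation-continuous : ∀ f → (∀ k → to f (inj₂ k) ≈ 0#) → ∀ x y →
    deviation f x y ≈ to f (inj₁ y) + - to f (inj₁ x)
  deviation-continuous f c≈0 x y = trans
    (+-congˡ (trans (-‿cong (jumpOf-zero em λ k _ _ → c≈0 k)) -0#≈0#)) (+-identityʳ _)

  include : C.Elem → Z.Elem
  include (g , g-cont) = extendByZero g ,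
    (let B , b = C.member⇒bdd g g-cont in
     B ∨ 0# , λ { (inj₁ x) → ≤-trans (b x) (x≤x∨y B 0#)
                ; (inj₂ k) → ≤-trans (≈⇒≤ ∣0∣) (y≤x∨y B 0#) }) ,
    c₀.zero-closed ,
    λ x ε 0<ε → let W , W-open , x∈W , close = g-cont x ε 0<ε in
      W , W-open , x∈W , λ {y} y∈W → ≤-<-trans
        (≈⇒≤ (∣∣-cong (deviation-continuous (extendByZero g) (λ _ → refl) x y))) (close y y∈W)

  ι : BoundedOperator ℝ (C K compact) Z
  ι = record
    { ⟦_⟧      = include
    ; isLinear = record
      { +ᴹ-isGroupHomomorphism = record
        { isMonoidHomomorphism = record
          { isMagmaHomomorphism = record
            { isRelHomomorphism = record
              { cong = λ q → λ { (inj₁ x) → q x ; (inj₂ k) → refl } }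
            ; homo = λ f g → λ { (inj₁ x) → refl ; (inj₂ k) → sym (+-identityˡ 0#) }
            }
          ; ε-homo = λ { (inj₁ x) → refl ; (inj₂ k) → refl }
          }
        ; ⁻¹-homo = λ f → λ { (inj₁ x) → refl ; (inj₂ k) → sym -0#≈0# }
        }
      ; *ₗ-homo = λ a f → λ { (inj₁ x) → refl ; (inj₂ k) → sym (zeroʳ a) }
      }
    ; bounded = 1# , λ f → ≤-resp refl (sym (*-identityˡ _))
        (Z.norm-lub (include f) (C.norm-nonneg f) λ
          { (inj₁ x) → C.∣f∣≤norm f x
          ; (inj₂ k) → ≤-trans (≈⇒≤ ∣0∣) (C.norm-nonneg f) })
    }

  π : BoundedOperator ℝ Z (c₀ κ)
  π = record
    { ⟦_⟧      = λ (f , _ , f-vanishing , _) → coefficients f , f-vanishing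
    ; isLinear = record
      { +ᴹ-isGroupHomomorphism = record
        { isMonoidHomomorphism = record
          { isMagmaHomomorphism = record
            { isRelHomomorphism = record { cong = λ q k → q (inj₂ k) }
            ; homo = λ f g k → refl
            }
          ; ε-homo = λ k → refl
          }
        ; ⁻¹-homo = λ f k → refl
        }
      ; *ₗ-homo = λ a f k → refl
      }
    ; bounded = 1# , λ f → ≤-resp refl (sym (*-identityˡ _))
        (c₀.norm-lub _ (Z.norm-nonneg f) λ k → Z.∣f∣≤norm f (inj₂ k))
    }

  open BoundedOperator using (Kernel; Range)

  kernel-ι : Kernel ι ≐ (C._≗ BanachSpace.0ᴹ (C K compact))
  kernel-ι = (λ q x → q (inj₁ x)) , λ q → λ { (inj₁ x) → q x ; (inj₂ k) → refl }

  kernel-π : Kernel π ≐ Range ι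
  kernel-π = (λ {f} → to-range f) , λ (g , q) k → sym (q (inj₂ k))
    where
    to-range : ∀ f → f ∈ Kernel π → f ∈ Range ι
    to-range (f , _ , _ , f-jumps) c≈0 =
      (atPoints f , λ x ε 0<ε → let W , W-open , x∈W , close = f-jumps x ε 0<ε in
        W , W-open , x∈W , λ y y∈W → ≤-<-trans
          (≈⇒≤ (∣∣-cong (sym (deviation-continuous f c≈0 x y)))) (close y∈W)) ,
      λ { (inj₁ x) → refl ; (inj₂ k) → sym (c≈0 k) }

-- Lifting `c₀(κ)` to `Z` along the chain.

module ChainLifting (em : ∀ {a} → ExcludedMiddle a) (ℝ : CompleteOrderedField)
  {ℓ i e} (K : TopologicalSpace ℓ) (compact : Compact K) (hausdorff : Hausdorff K)
  (κ : Setoid i e) (V : Setoid.Carrier κ → Pred (TopologicalSpace.Point K) ℓ)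
  (V-open : ∀ k → TopologicalSpace.IsOpen K (V k))
  (V-cong : ∀ {j k} → Setoid._≈_ κ j k → V j ⊆ V k)
  (comparable : ∀ j k → Setoid._≈_ κ j k ⊎ _⋖_ K (V j) (V k) ⊎ _⋖_ K (V k) (V j)) where

  open Real ℝ
  open SupNorm em ℝ
  open TopologicalSpace K
  open Topology em K
  open GeometricSequences em ℝ
  open IntegerCoefficients commutativeRing
  open Urysohn em ℝ K compact hausdorff
  open JumpSpace em ℝ K compact κ V
  open Setoid κ using () renaming (Carrier to Index; _≈_ to _≈ᵢ_)
  open ListMembership κ using () renaming (_∈_ to _∈ᴸ_)
  open Func using (to; cong)

  private
    module κ = Setoid κ
    module c₀ = FunctionSpace (vanishingFunctions κ)
    module Z = FunctionSpace jumpFunctions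

  _at_ : Z.Elem → Setoid.Carrier domain → Carrier
  f at p = to (proj₁ f) p

  -- If the closure of `V j` lies in `V k`, a point of the boundary of `V j` lies in the open set
  -- `V k`, which misses its own boundary.
  ∂-unique : ∀ {x j k} → x ∈ ∂ K (V j) → x ∈ ∂ K (V k) → j ≈ᵢ k
  ∂-unique {j = j} {k} x∈∂j x∈∂k with comparable j k
  ... | inj₁ j≈k          = j≈k
  ... | inj₂ (inj₁ Vj⋖Vk) = ⊥-elim (∂-disjoint (V-open k) x∈∂k (Vj⋖Vk (proj₁ x∈∂j)))
  ... | inj₂ (inj₂ Vk⋖Vj) = ⊥-elim (∂-disjoint (V-open j) x∈∂j (Vk⋖Vj (proj₁ x∈∂k)))

  unit : Index → Index → Carrier
  unit k j = indicator (em {P = k ≈ᵢ j})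

  unit-at : ∀ {k j} → k ≈ᵢ j → unit k j ≈ 1#
  unit-at = indicator-yes em

  unit-off : ∀ {k j} → ¬ k ≈ᵢ j → unit k j ≈ 0#
  unit-off = indicator-no em

  unit≉0 : ∀ {k j} → ¬ unit k j ≈ 0# → k ≈ᵢ j
  unit≉0 q = decidable-stable em λ k≉j → q (unit-off k≉j)

  χ : Index → Point → Carrier
  χ k x = indicator (em {P = x ∈ V k})

  χ-in : ∀ {k x} → x ∈ V k → χ k x ≈ 1#
  χ-in = indicator-yes em

  χ-out : ∀ {k x} → x ∉ V k → χ k x ≈ 0#
  χ-out = indicator-no em

  -- Inside `V k` and off its closure, `χ k` is locally constant and `x` is on no boundary with
  -- index `k`. On the boundary `χ k x` is 0 and the equation holds for all `y`, as `jump` can only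
  -- select `k` by `∂-unique`.
  jump-χ : ∀ k x → x ∈ interior K (λ y → χ k y + - χ k x ≈ jump (unit k) x y)
  jump-χ k x with em {P = x ∈ V k}
  ... | yes x∈V = interior-mono
    (λ {y} y∈V → trans (+-congʳ (χ-in y∈V)) (trans (-‿inverseʳ 1#) (sym (jumpOf-zero {x} {y} em
      λ j x∈∂ _ → unit-off λ k≈j → ∂-disjoint (V-open j) x∈∂ (V-cong k≈j x∈V)))))
    (open⇒interior (V-open k) x∈V)
  ... | no x∉V with em {P = x ∈ closure K (V k)}
  ...   | no x∉cl = interior-mono
    (λ {y} y∉V → trans (+-congʳ (χ-out y∉V)) (trans (-‿inverseʳ 0#) (sym (jumpOf-zero {x} {y} em
      λ j x∈∂ _ → unit-off λ k≈j → x∉cl (closure-mono (V-cong (κ.sym k≈j)) (proj₁ x∈∂))))))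
    (∉closure⇒interior x∉cl)
  ...   | yes x∈cl = universal⇒interior (λ y → near y em) x
    where
    x∈∂ : x ∈ ∂ K (V k)
    x∈∂ = x∈cl , ⊆closure x∉V
    near : ∀ y → Dec (y ∈ V k) → χ k y + - 0# ≈ jump (unit k) x y
    near y (yes y∈V) = trans (+-cong (χ-in y∈V) -0#≈0#) (trans (+-identityʳ 1#)
      (sym (trans
        (jumpOf-eval {x} {y} em x∈∂ y∈V λ j x∈∂j →
          trans (unit-at (∂-unique x∈∂ x∈∂j)) (sym (unit-at κ.refl)))
        (unit-at κ.refl))))
    near y (no y∉V) = trans (+-cong (χ-out y∉V) -0#≈0#) (trans (+-identityʳ 0#)
      (sym (jumpOf-zero {x} {y} em λ j _ y∈Vj → unit-off λ k≈j → y∉V (V-cong (κ.sym k≈j) y∈Vj))))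

  module DisjointSums (F : List Index) (b : Index → Z.Elem)
    (b-unit : ∀ k j → b k at inj₂ j ≈ unit k j)
    (b-disjoint : ∀ {j k} → j ∈ᴸ F → k ∈ᴸ F →
      ∀ p → ¬ b j at p ≈ 0# → ¬ b k at p ≈ 0# → j ≈ᵢ k)
    (c : Fun κ) where

    -- Disjoint supports make a sum a single term at each point, so its norm is governed by the
    -- largest term.
    SingleTerm : List Index → Z.Elem → Setoid.Carrier domain → Set _
    SingleTerm ks w p = w at p ≈ 0# ⊎
      ∃ λ k → k ∈ᴸ ks × ¬ b k at p ≈ 0# × w at p ≈ to c k * b k at p

    SumsTo : List Index → Z.Elem → Set _
    SumsTo ks w = (∀ p → SingleTerm ks w p) × (∀ j → j ∈ᴸ ks → w at inj₂ j ≈ to c j)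

    vanishes-off : ∀ ks w → (∀ p → SingleTerm ks w p) → ∀ j → ¬ j ∈ᴸ ks → w at inj₂ j ≈ 0#
    vanishes-off ks w single j j∉ks with single (inj₂ j)
    ... | inj₁ w≈0                   = w≈0
    ... | inj₂ (k , k∈ks , bk≉0 , _) =
      ⊥-elim (j∉ks (∈-resp-≈ κ (unit≉0 λ q → bk≉0 (trans (b-unit k j) q)) k∈ks))

    module _ (k : Index) (ks : List Index) (⊆F : ∀ {j} → j ∈ᴸ (k ∷ ks) → j ∈ᴸ F)
      (w : Z.Elem) (single : ∀ p → SingleTerm ks w p)
      (value : ∀ j → j ∈ᴸ ks → w at inj₂ j ≈ to c j) (k∉ks : ¬ k ∈ᴸ ks) where

      w+ck·bk : Z.Elem
      w+ck·bk = BanachSpace._+ᴹ_ Z w (BanachSpace._*ₗ_ Z (to c k) (b k))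

      unchanged : ∀ p → b k at p ≈ 0# → w+ck·bk at p ≈ w at p
      unchanged p b≈0 = trans (+-congˡ (trans (*-congˡ b≈0) (zeroʳ _))) (+-identityʳ _)

      single′ : ∀ p → Dec (b k at p ≈ 0#) → SingleTerm ks w p → SingleTerm (k ∷ ks) w+ck·bk p
      single′ p (yes b≈0) (inj₁ w≈0) = inj₁ (trans (unchanged p b≈0) w≈0)
      single′ p (yes b≈0) (inj₂ (j , j∈ks , bj≉0 , w≈)) =
        inj₂ (j , there j∈ks , bj≉0 , trans (unchanged p b≈0) w≈)
      single′ p (no b≉0) (inj₁ w≈0) =
        inj₂ (k , here κ.refl , b≉0 , trans (+-congʳ w≈0) (+-identityˡ _))
      single′ p (no b≉0) (inj₂ (j , j∈ks , bj≉0 , _)) = ⊥-elim (k∉ks (∈-resp-≈ κ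
        (b-disjoint (⊆F (there j∈ks)) (⊆F (here κ.refl)) p bj≉0 b≉0) j∈ks))

      value′ : ∀ j → j ∈ᴸ (k ∷ ks) → w+ck·bk at inj₂ j ≈ to c j
      value′ j (here j≈k) = trans
        (+-cong (vanishes-off ks w single j λ j∈ks → k∉ks (∈-resp-≈ κ j≈k j∈ks))
          (trans (*-congˡ (trans (b-unit k j) (unit-at (κ.sym j≈k)))) (*-identityʳ _)))
        (trans (+-identityˡ _) (cong c (κ.sym j≈k)))
      value′ j (there j∈ks) = trans
        (unchanged (inj₂ j) (trans (b-unit k j)
          (unit-off λ k≈j → k∉ks (∈-resp-≈ κ (κ.sym k≈j) j∈ks))))
        (value j j∈ks)

    sum : ∀ ks → (∀ {k} → k ∈ᴸ ks → k ∈ᴸ F) → ∃ (SumsTo ks)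
    sum []       ⊆F = BanachSpace.0ᴹ Z , (λ p → inj₁ refl) , λ j ()
    sum (k ∷ ks) ⊆F = insert (sum ks λ k∈ → ⊆F (there k∈)) em
      where
      insert : ∃ (SumsTo ks) → Dec (k ∈ᴸ ks) → ∃ (SumsTo (k ∷ ks))
      -- The list may repeat an index; a repeated one is not added again.
      insert (w , single , value) (yes k∈ks) = w ,
        (λ p → [ inj₁ , (λ (j , j∈ks , rest) → inj₂ (j , there j∈ks , rest)) ]′ (single p)) ,
        λ j → λ { (here j≈k)   → value j (∈-resp-≈ κ (κ.sym j≈k) k∈ks)
                ; (there j∈ks) → value j j∈ks }
      insert (w , single , value) (no k∉ks) =
        w+ck·bk k ks ⊆F w single value k∉ks ,
        (λ p → single′ k ks ⊆F w single value k∉ks p em (single p)) ,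
        value′ k ks ⊆F w single value k∉ks

  module _ (F : List Index) where

    -- Provides the set on which the bump of `k` is switched off: it swallows all listed `V j`
    -- strictly below `V k`.
    below : ∀ k → ∃ λ B → IsOpen B × _⋖_ K B (V k) ×
      (∀ x → Any (λ j → (¬ j ≈ᵢ k × _⋖_ K (V j) (V k)) × x ∈ V j) F → x ∈ B)
    below k = finite-⋃-⋖ V (λ j (_ , Vj⋖Vk) → V-open j , Vj⋖Vk) F

    gap : Index → Gap
    gap k = let B , _ , B⋖V , _ = below k in
      record { inner = B ; outer = V k ; outer-open = V-open k ; inner⋖outer = B⋖V }

    cutoff : Index → Fun points
    cutoff k = proj₁ (urysohn (gap k))

    -- Subtracting a continuous function keeps the jump of `χ k`. The cutoff is 1 on the set from
    -- `below k` and 0 off `V k`, so the bump lives between the two.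
    bump : Index → Z.Elem
    bump k = b , bounded , vanishing , jumps
      where
      g : Fun points
      g = cutoff k
      b : Fun domain
      b = record
        { to   = [ (λ x → χ k x + - to g x) , unit k ]′
        ; cong = λ { (Pointwise.inj₁ q) → +-cong
                       (indicator-cong em em (open-resp-≈ (V-open k) q)
                         (open-resp-≈ (V-open k) (Setoid.sym points q)))
                       (-‿cong (cong g q))
                   ; (Pointwise.inj₂ q) → indicator-cong em em
                       (λ k≈ → κ.trans k≈ q) (λ k≈ → κ.trans k≈ (κ.sym q)) }
        }
      bounded : Bounded b
      -- `staircase 0 (gap k)` is `χ k`, so the Urysohn error estimate bounds the bump by 2.
      bounded = 1# + 1# , λ
        { (inj₁ x) → ≤-resp (∣sub∣-comm _ _) refl
                       (proj₂ (proj₂ (proj₂ (proj₂ (urysohn (gap k))))) x)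
        ; (inj₂ j) → ≤-trans (≈⇒≤ (nonneg⇒∣∣ (0≤indicator em)))
                       (≤-trans (indicator≤1 em) (x≤x+nonneg 0≤1)) }
      vanishing : Vanishing κ (coefficients b)
      vanishing ε 0<ε = k ∷ [] , λ j ε< → here (κ.sym (unit≉0 λ q →
        <⇒≱ (<-≤-trans ε< (≈⇒≤ (trans (∣∣-cong q) ∣0∣))) (proj₁ 0<ε)))
      jumps : JumpsByCoefficients b
      jumps x ε 0<ε = let W , W-open , x∈W , close = proj₁ (proj₂ (urysohn (gap k))) x ε 0<ε in
        interior-mono
          (λ {y} (q , d) → ≤-<-trans (≈⇒≤ (trans (∣∣-cong (trans
            (+-congˡ (-‿cong (sym q)))
            (solve 4 (λ a b c d → ((a :+ :- b) :+ :- (c :+ :- d)) :+ :- (a :+ :- c) := d :+ :- b)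
              refl (χ k y) (to g y) (χ k x) (to g x)))) (∣sub∣-comm _ _))) d)
          (interior-∩ (jump-χ k x) (W , W-open , x∈W , λ {y} → close y))

    -- A point where `bump j` is nonzero lies in `V j`, hence in the set from `below k`, where `χ k`
    -- and the cutoff are both 1. At index coordinates, distinct unit vectors are disjoint.
    bump-dominated : ∀ {j k} → j ∈ᴸ F → ¬ j ≈ᵢ k → _⋖_ K (V j) (V k) →
      ∀ p → ¬ bump j at p ≈ 0# → bump k at p ≈ 0#
    bump-dominated {j} {k} j∈F j≉k Vj⋖Vk (inj₂ m) bj≉0 = unit-off λ k≈m →
      j≉k (κ.trans (unit≉0 bj≉0) (κ.sym k≈m))
    bump-dominated {j} {k} j∈F j≉k Vj⋖Vk (inj₁ x) bj≉0 = trans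
      (+-cong (χ-in (Vj⋖Vk (⊆closure x∈Vj)))
        (-‿cong (proj₁ (proj₂ (proj₂ (urysohn (gap k)))) x x∈B)))
      (-‿inverseʳ 1#)
      where
      x∈Vj : x ∈ V j
      x∈Vj = decidable-stable em λ x∉Vj → bj≉0 (trans
        (+-cong (χ-out x∉Vj) (-‿cong (proj₁ (proj₂ (proj₂ (proj₂ (urysohn (gap j))))) x x∉Vj)))
        (-‿inverseʳ 0#))
      x∈B : x ∈ Gap.inner (gap k)
      x∈B = proj₂ (proj₂ (proj₂ (below k))) x (Any.map
        (λ j≈i → ((λ i≈k → j≉k (κ.trans j≈i i≈k)) , λ {y} → Vi⋖Vk j≈i {y}) , V-cong j≈i x∈Vj) j∈F)
        where
        Vi⋖Vk : ∀ {i} → j ≈ᵢ i → _⋖_ K (V i) (V k)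
        Vi⋖Vk j≈i = ⋖-monoˡ (V-cong (κ.sym j≈i)) Vj⋖Vk

    bump-disjoint : ∀ {j k} → j ∈ᴸ F → k ∈ᴸ F →
      ∀ p → ¬ bump j at p ≈ 0# → ¬ bump k at p ≈ 0# → j ≈ᵢ k
    bump-disjoint {j} {k} j∈F k∈F p bj≉0 bk≉0 = decidable-stable em λ j≉k → absurd j≉k (comparable j k)
      where
      absurd : ¬ j ≈ᵢ k → ¬ (j ≈ᵢ k ⊎ _⋖_ K (V j) (V k) ⊎ _⋖_ K (V k) (V j))
      absurd j≉k (inj₁ j≈k)          = j≉k j≈k
      absurd j≉k (inj₂ (inj₁ Vj⋖Vk)) = bk≉0 (bump-dominated j∈F j≉k Vj⋖Vk p bj≉0)
      absurd j≉k (inj₂ (inj₂ Vk⋖Vj)) =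
        bj≉0 (bump-dominated k∈F (λ k≈j → j≉k (κ.sym k≈j)) Vk⋖Vj p bk≉0)

  bumps : ∀ F → ∃ λ (b : Index → Z.Elem) → (∀ k j → b k at inj₂ j ≈ unit k j) ×
    (∀ {j k} → j ∈ᴸ F → k ∈ᴸ F → ∀ p → ¬ b j at p ≈ 0# → ¬ b k at p ≈ 0# → j ≈ᵢ k) ×
    (∀ k p → ∣ b k at p ∣ ≤ 1# + 1#)
  bumps F = bump F , (λ k j → refl) , bump-disjoint F , λ k → proj₂ (proj₁ (proj₂ (bump F k)))

  -- The finite list `F` contains all indices with `∣ c k ∣ > ρ/4`. A disjoint sum of bumps lifts
  -- these coefficients exactly, with norm at most twice `ρ/2`. The others form the residual, whose
  -- bound is the hypothesis of the next round, with `½ * ρ` for `ρ`.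
  approximateLift : ∀ {ρ} (c : Fun κ) → Vanishing κ c → 0# < ρ → (∀ k → ∣ to c k ∣ ≤ ½ * ρ) →
    ∃ λ w → (∀ p → ∣ w at p ∣ ≤ ρ) × (∀ k → ∣ to c k + - (w at inj₂ k) ∣ ≤ ½ * (½ * ρ))
  approximateLift {ρ} c c-vanishing 0<ρ c-bound = w , bound , residual
    where
    F : List Index
    F = proj₁ (c-vanishing (½ * (½ * ρ)) (0<½x (0<½x 0<ρ)))
    b : Index → Z.Elem
    b = proj₁ (bumps F)
    b-bound : ∀ k p → ∣ b k at p ∣ ≤ 1# + 1#
    b-bound = proj₂ (proj₂ (proj₂ (bumps F)))
    open DisjointSums F b (proj₁ (proj₂ (bumps F))) (proj₁ (proj₂ (proj₂ (bumps F)))) c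
    w : Z.Elem
    w = proj₁ (sum F λ k∈F → k∈F)
    sums : SumsTo F w
    sums = proj₂ (sum F λ k∈F → k∈F)
    bound : ∀ p → ∣ w at p ∣ ≤ ρ
    bound p = single (proj₁ sums p)
      where
      single : SingleTerm F w p → ∣ w at p ∣ ≤ ρ
      single (inj₁ w≈0) = ≤-trans (≈⇒≤ (trans (∣∣-cong w≈0) ∣0∣)) (proj₁ 0<ρ)
      single (inj₂ (k , _ , _ , w≈)) = ≤-trans
        (≈⇒≤ (trans (∣∣-cong w≈) (∣∣-* (to c k) (b k at p))))
        (≤-trans (*-monoˡ-≤ (∣∣-nonneg (to c k)) (b-bound k p))
          (≤-trans (≈⇒≤ (*-comm (∣ to c k ∣) (1# + 1#)))
            (≤-trans (*-monoˡ-≤ (proj₁ 0<2) (c-bound k))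
              (≈⇒≤ (trans (distribʳ (½ * ρ) 1# 1#)
                (trans (+-cong (*-identityˡ (½ * ρ)) (*-identityˡ (½ * ρ))) (½x+½x≈x ρ)))))))
    residual : ∀ k → ∣ to c k + - (w at inj₂ k) ∣ ≤ ½ * (½ * ρ)
    residual k = cases em
      where
      cases : Dec (k ∈ᴸ F) → ∣ to c k + - (w at inj₂ k) ∣ ≤ ½ * (½ * ρ)
      cases (yes k∈F) = ≤-trans
        (≈⇒≤ (trans (∣∣-cong (trans (+-congˡ (-‿cong (proj₂ sums k k∈F))) (-‿inverseʳ (to c k)))) ∣0∣))
        (proj₁ (0<½x (0<½x 0<ρ)))
      cases (no k∉F) = ≤-trans
        (≈⇒≤ (∣∣-cong (trans
          (+-congˡ (trans (-‿cong (vanishes-off F w (proj₁ sums) k k∉F)) -0#≈0#))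
          (+-identityʳ (to c k)))))
        (decidable-stable em λ large → k∉F (proj₂ (c-vanishing _ (0<½x (0<½x 0<ρ))) k (≰⇒> large)))

  module _ {ρ} (0<ρ : 0# < ρ) (c : c₀.Elem) (c-bound : ∀ k → ∣ to (proj₁ c) k ∣ ≤ ½ * ρ) where

    private
      g : ℕ → Carrier
      g = geometric ρ
      0<g : ∀ n → 0# < g n
      0<g = geometric-positive (proj₁ 0<ρ) 0<ρ

    LiftUpTo : ℕ → Set _
    LiftUpTo n = ∃ λ z → ∀ k → ∣ to (proj₁ c) k + - (z at inj₂ k) ∣ ≤ ½ * g n

    -- The coefficients that `z` still misses are at most `½ * g n`, so correcting them costs norm
    -- at most `g n` and halves the bound on the remainder.
    refine : ∀ n (z : LiftUpTo n) → ∃ λ (z′ : LiftUpTo (ℕ.suc n)) →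
      ∀ p → ∣ (proj₁ z′ at p) + - (proj₁ z at p) ∣ ≤ g n
    refine n (z , close) =
      let w , w-bound , residual = approximateLift
            (addᶠ κ (proj₁ c) (negᶠ κ (coefficients (proj₁ z))))
            (c₀.add-closed (proj₁ c) (negᶠ κ (coefficients (proj₁ z))) (proj₂ c)
              (c₀.neg-closed (coefficients (proj₁ z)) (proj₁ (proj₂ (proj₂ z)))))
            (0<g n) close
      in (BanachSpace._+ᴹ_ Z z w , λ k → ≤-resp
           (∣∣-cong (solve 3 (λ c z w → (c :+ :- z) :+ :- w := c :+ :- (z :+ w)) refl _ _ _)) refl
           (residual k)) ,
         λ p → ≤-resp (∣∣-cong (solve 2 (λ z w → w := (z :+ w) :+ :- z) refl _ _)) refl (w-bound p)

    lifts : ∀ n → LiftUpTo n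
    lifts zero      = BanachSpace.0ᴹ Z , λ k → ≤-resp
      (∣∣-cong (sym (trans (+-congˡ -0#≈0#) (+-identityʳ _)))) refl (c-bound k)
    lifts (ℕ.suc n) = proj₁ (refine n (lifts n))

    boundedLift : ∃ λ z → (∀ k → z at inj₂ k ≈ to (proj₁ c) k) × (∀ p → ∣ z at p ∣ ≤ ρ + ρ)
    boundedLift = (F , Z.limit-closed F member) ,
      (λ k → approximations-unique λ ε 0<ε →
        let n , small = 2geometric-small (proj₁ 0<ρ) ε 0<ε in
        proj₁ (lifts n) at inj₂ k , ≤-trans (F-close n (inj₂ k)) small ,
        ≤-trans (proj₂ (lifts n) k) (≤-trans (½x≤x (proj₁ (0<g n)))
          (≤-trans (x≤x+nonneg (proj₁ (0<g n))) small))) ,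
      -- Approximant 0 is zero, so the distance to it bounds `F` itself.
      λ p → ≤-resp (∣∣-cong (trans (+-congˡ -0#≈0#) (+-identityʳ _))) refl (F-close 0 p)
      where
      approximants : ℕ → Fun domain
      approximants n = proj₁ (proj₁ (lifts n))
      F : Fun domain
      F = proj₁ (uniformLimit domain (proj₁ 0<ρ) approximants λ n → proj₂ (refine n (lifts n)))
      F-close : ∀ n p → ∣ to F p + - to (approximants n) p ∣ ≤ g n + g n
      F-close = proj₂ (uniformLimit domain (proj₁ 0<ρ) approximants λ n → proj₂ (refine n (lifts n)))
      member : ∀ ε → 0# < ε → ∃ λ f → Z.Member f × (∀ p → ∣ to F p + - to f p ∣ ≤ ε)
      member ε 0<ε = let n , small = 2geometric-small (proj₁ 0<ρ) ε 0<ε in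
        approximants n , proj₂ (proj₁ (lifts n)) , λ p → ≤-trans (F-close n p) small

  π-surjective : ∀ c → c ∈ BoundedOperator.Range π
  π-surjective c =
    -- Adding 1 keeps `ρ` positive when `c` is zero.
    let ρ = c₀.norm c + 1#
        0<ρ = <-≤-trans 0<1 (≤-resp refl (+-comm 1# (c₀.norm c)) (x≤x+nonneg (c₀.norm-nonneg c)))
        0<ρ+ρ = <-≤-trans 0<ρ (x≤x+nonneg (proj₁ 0<ρ))
        z , z≈c , _ = boundedLift 0<ρ+ρ c λ k → ≤-resp refl (sym (½[x+x]≈x ρ))
          (≤-trans (c₀.∣f∣≤norm c k) (x≤x+nonneg 0≤1))
    in z , z≈c

  -- Functions with a unit jump are large near the boundary.

  ¼ : Carrier
  ¼ = ½ * ½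

  0<¼ : 0# < ¼
  0<¼ = 0<½x 0<½

  module _ (k : Index) (V-regular : interior K (closure K (V k)) ⊆ V k)
    (w : Fun domain) (w-jumps : JumpsByCoefficients w) (w-unit : ∀ j → to w (inj₂ j) ≈ unit k j)
    where

    private
      v : Point → Carrier
      v x = to w (inj₁ x)

    -- The last clause ensures that a boundary found later inside `W′` belongs to a new index; the
    -- factor `σ` absorbs the sign of `w`.
    LargeIn : Pred Point ℓ → Set _
    LargeIn W = ∃ λ σ → ∣ σ ∣ ≤ 1# × ∃ λ W′ → IsOpen W′ × ∃ (_∈ W′) × W′ ⊆ W ×
      (∀ y → y ∈ W′ → ¼ ≤ σ * v y) × (∀ y → y ∈ W′ → y ∉ ∂ K (V k))

    module _ {W x} (W-open : IsOpen W) (x∈W : x ∈ W) (x∈∂ : x ∈ ∂ K (V k))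
      (close : ∀ y → y ∈ W → ∣ deviation w x y ∣ < ¼) where

      -- On the side of `V k` the values exceed `v x` by 1 up to an error ¼, so they are at least
      -- `-½ + 1 - ¼`.
      large-inside : - ½ ≤ v x → LargeIn W
      large-inside -½≤vx = 1# , ≈⇒≤ (nonneg⇒∣∣ 0≤1) , W ∩ V k , open-∩ W-open (V-open k) ,
        proj₁ x∈∂ W W-open x∈W , proj₁ ,
        (λ y (y∈W , y∈V) → ≤-trans (large y y∈W y∈V) (≈⇒≤ (sym (*-identityˡ (v y))))) ,
        λ y (_ , y∈V) y∈∂ → ∂-disjoint (V-open k) y∈∂ y∈V
        where
        large : ∀ y → y ∈ W → y ∈ V k → ¼ ≤ v y
        large y y∈W y∈V = +-cancelʳ-≤ ¼ (≤-resp
          (trans (+-congʳ (sym ½+½≈1)) (trans (x+y-y ½ ½) (sym (½x+½x≈x ½))))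
          (solve 3 (λ q s t → (q :+ (s :+ :- t)) :+ t := s :+ q) refl ¼ (v y) (v x))
          (+-mono-≤ 1≤ -½≤vx))
          where
          jump≈1 : jump (λ j → to w (inj₂ j)) x y ≈ 1#
          jump≈1 = trans
            (jumpOf-eval {x} {y} em x∈∂ y∈V λ j x∈∂j → cong w (Pointwise.inj₂ (∂-unique x∈∂j x∈∂)))
            (trans (w-unit k) (unit-at κ.refl))
          1≤ : 1# ≤ ¼ + (v y + - v x)
          1≤ = dist≤⇒≤+ (≤-resp
            (trans (∣sub∣-comm (v y + - v x) _) (∣∣-cong (+-congʳ jump≈1))) refl
            (proj₁ (close y y∈W)))

      -- Off `V k` the values stay within ¼ of `v x`, so they are at most `-¼`. Regularity is what
      -- gives the outside of `V k` interior points in `W`.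
      large-outside : v x ≤ - ½ → LargeIn W
      large-outside vx≤-½ = - 1# , ≈⇒≤ (trans (∣-x∣ 1#) (nonneg⇒∣∣ 0≤1)) ,
        W ∩ H , open-∩ W-open H-open , (y₀ , y₀∈W , y₀∈H) , proj₁ ,
        (λ y (y∈W , y∈H) → ≤-trans (large y y∈W (H⊆ y∈H))
          (≈⇒≤ (trans (-‿cong (sym (*-identityˡ (v y)))) (-‿distribˡ-* 1# (v y))))) ,
        λ y (_ , y∈H) (y∈cl , _) → let z , z∈H , z∈V = y∈cl H H-open y∈H in H⊆ z∈H z∈V
        where
        exit : ∃ λ y → y ∈ W × y ∉ closure K (V k)
        -- If `W` were contained in the closure of `V k`, then `x` would be interior to that
        -- closure, hence in `V k`, although it lies on the boundary.
        exit = decidable-stable em λ none → ∂-disjoint (V-open k) x∈∂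
          (V-regular (W , W-open , x∈W ,
            λ {y} y∈W → decidable-stable em λ y∉cl → none (y , y∈W , y∉cl)))
        y₀ : Point
        y₀ = proj₁ exit
        y₀∈W : y₀ ∈ W
        y₀∈W = proj₁ (proj₂ exit)
        away : y₀ ∈ interior K (∁ (V k))
        away = ∉closure⇒interior (proj₂ (proj₂ exit))
        H : Pred Point ℓ
        H = proj₁ away
        H-open : IsOpen H
        H-open = proj₁ (proj₂ away)
        y₀∈H : y₀ ∈ H
        y₀∈H = proj₁ (proj₂ (proj₂ away))
        H⊆ : H ⊆ ∁ (V k)
        H⊆ = proj₂ (proj₂ (proj₂ away))
        large : ∀ y → y ∈ W → y ∉ V k → ¼ ≤ - v y
        large y y∈W y∉V = ≤-resp (-‿involutive ¼) refl (neg-mono (≤-trans vy≤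
          (≤-trans (+-mono-≤ (≤-refl {¼}) vx≤-½) (≈⇒≤ (trans
            (+-congˡ (-‿cong (sym (½x+½x≈x ½))))
            (solve 1 (λ q → q :+ :- (q :+ q) := :- q) refl ¼))))))
          where
          jump≈0 : jump (λ j → to w (inj₂ j)) x y ≈ 0#
          jump≈0 = jumpOf-zero {x} {y} em λ j _ y∈Vj →
            trans (w-unit j) (unit-off λ k≈j → y∉V (V-cong (κ.sym k≈j) y∈Vj))
          vy≤ : v y ≤ ¼ + v x
          vy≤ = dist≤⇒≤+ (≤-resp
            (∣∣-cong (trans (+-congˡ (trans (-‿cong jump≈0) -0#≈0#)) (+-identityʳ (v y + - v x)))) refl
            (proj₁ (close y y∈W)))

    -- The two one-sided values of w at x differ by 1, so one of them is at least ½ in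
    -- absolute value; regularity makes both sides of the boundary accessible.
    large-near-∂ : ∀ {W x} → IsOpen W → x ∈ W → x ∈ ∂ K (V k) → LargeIn W
    large-near-∂ {W} {x} W-open x∈W x∈∂ =
      let G , G-open , x∈G , G⊆ = w-jumps x ¼ 0<¼
          O-open = open-∩ G-open W-open
          close  = λ y y∈G∩W → G⊆ {y} (proj₁ y∈G∩W)
          σ , σ≤1 , W′ , W′-open , inhabited , W′⊆ , large , avoids =
            [ large-inside O-open (x∈G , x∈W) x∈∂ close
            , large-outside O-open (x∈G , x∈W) x∈∂ close
            ]′ (O.total (- ½) (v x))
      in σ , σ≤1 , W′ , W′-open , inhabited , (λ y∈W′ → proj₂ (W′⊆ y∈W′)) , large , avoids

  -- No bounded left inverse of `ι`.

  module Nontriviality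
    (point : Point)
    (∂-dense : ∀ W → IsOpen W → ∀ x → x ∈ W → ∃ λ k → ∃ λ y → y ∈ W × y ∈ ∂ K (V k))
    (regular : ∀ k → interior K (closure K (V k)) ⊆ V k)
    (ϖ : BoundedOperator ℝ Z (C K compact))
    (retraction : ∀ g → BanachSpace._≈ᴹ_ (C K compact)
      (BoundedOperator.⟦_⟧ ϖ (BoundedOperator.⟦_⟧ ι g)) g)
    where

    private
      module ZB = BanachSpace Z
      module CK = FunctionSpace (continuousFunctions K compact)
      module ϖ = BoundedOperator ϖ
      module ϖ-linear = LeftModuleMorphisms.IsLeftModuleHomomorphism ϖ.isLinear

    T : Z.Elem → Z.Elem
    T z = z ZB.+ᴹ ZB.-ᴹ (include ϖ.⟦ z ⟧)

    Tₓ : Z.Elem → Point → Carrier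
    Tₓ z x = T z at inj₁ x

    T-+ : ∀ z w x → Tₓ (z ZB.+ᴹ w) x ≈ Tₓ z x + Tₓ w x
    T-+ z w x = trans (+-congˡ (-‿cong (ϖ-linear.+ᴹ-homo z w x)))
      (sym (sub-add _ _ _ _))

    T-* : ∀ a z x → Tₓ (a ZB.*ₗ z) x ≈ a * Tₓ z x
    T-* a z x = trans (+-congˡ (-‿cong (ϖ-linear.*ₗ-homo a z x))) (sub-scale a _ _)

    T-kernel : ∀ z → (∀ k → z at inj₂ k ≈ 0#) → ∀ x → Tₓ z x ≈ 0#
    T-kernel z c≈0 x =
      let g , ιg≈z = proj₁ kernel-π {z} c≈0 in
      trans (+-cong (sym (ιg≈z (inj₁ x)))
              (-‿cong (trans (ϖ-linear.⟦⟧-cong {z} {include g} (λ p → sym (ιg≈z p)) x)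
                             (retraction g x))))
        (-‿inverseʳ _)

    -- By linearity this is `T-kernel` for `z - w`; thus `T` factors through `π`.
    T-coefficients : ∀ z w → (∀ k → z at inj₂ k ≈ w at inj₂ k) → ∀ x → Tₓ z x ≈ Tₓ w x
    T-coefficients z w z≈w x = trans (sym (+-identityʳ (Tₓ z x))) (trans
      (+-congˡ (sym (-‿inverseˡ (Tₓ w x)))) (trans (sym (+-assoc _ _ _)) (trans
        (+-congʳ (trans (+-congˡ (trans (-‿cong (sym (*-identityˡ _))) (-‿distribˡ-* _ _)))
          (trans (sym (trans (T-+ z (- 1# ZB.*ₗ w) x) (+-congˡ (T-* (- 1#) w x))))
            (T-kernel (z ZB.+ᴹ (- 1# ZB.*ₗ w)) (λ k → trans
              (+-cong (z≈w k) (trans (sym (-‿distribˡ-* _ _)) (-‿cong (*-identityˡ _))))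
              (-‿inverseʳ _)) x))))
        (+-identityˡ (Tₓ w x)))))

    -- The norm of `z` is not controlled, so `z` is replaced by a bounded lift of the same
    -- coefficients, on which `T` has the same values.
    T-bounded : ∃ λ M → ∀ z → (∀ k → ∣ z at inj₂ k ∣ ≤ 1#) → ∀ x → Tₓ z x ≤ M
    T-bounded = M , bound
      where
      B R M : Carrier
      B = proj₁ ϖ.bounded
      -- `boundedLift` with `ρ = 2` accepts coefficients of modulus up to 1 and bounds the lift by
      -- `2ρ = 4`.
      R = (1# + 1#) + (1# + 1#)
      M = R + ∣ B ∣ * R
      bound : ∀ z → (∀ k → ∣ z at inj₂ k ∣ ≤ 1#) → ∀ x → Tₓ z x ≤ M
      bound z z≤1 x = ≤-trans (≈⇒≤ (T-coefficients z w (λ k → sym (w≈z k)) x))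
        (+-mono-≤ (≤-trans (x≤∣x∣ (w at inj₁ x)) (w-bound (inj₁ x)))
          (≤-trans (-x≤∣x∣ (to (proj₁ ϖ.⟦ w ⟧) x)) (≤-trans (CK.∣f∣≤norm ϖ.⟦ w ⟧ x)
            (≤-trans (proj₂ ϖ.bounded w)
              (≤-trans (≤-resp (*-comm (Z.norm w) B) (*-comm (Z.norm w) ∣ B ∣)
                  (*-monoˡ-≤ (Z.norm-nonneg w) (x≤∣x∣ B)))
                (*-monoˡ-≤ (∣∣-nonneg B)
                  (Z.norm-lub w (≤-trans (proj₁ 0<2) (x≤x+nonneg (proj₁ 0<2))) w-bound)))))))
        where
        z-coefficients : c₀.Elem
        z-coefficients = coefficients (proj₁ z) , proj₁ (proj₂ (proj₂ z))
        lifted : ∃ λ w → (∀ k → w at inj₂ k ≈ z at inj₂ k) × (∀ p → ∣ w at p ∣ ≤ R)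
        lifted = boundedLift 0<2 z-coefficients λ k →
          ≤-resp refl (sym (½[x+x]≈x 1#)) (z≤1 k)
        w : Z.Elem
        w = proj₁ lifted
        w≈z : ∀ k → w at inj₂ k ≈ z at inj₂ k
        w≈z = proj₁ (proj₂ lifted)
        w-bound : ∀ p → ∣ w at p ∣ ≤ R
        w-bound = proj₂ (proj₂ lifted)

    -- Besides the lower bound on `W`, the invariant records that indices already used by `z` have
    -- no boundary points in `W`; the next index found there is therefore new.
    Attained : Pred Carrier _
    Attained r = ∃ λ z → (∀ k → ∣ z at inj₂ k ∣ ≤ 1#) × ∃ λ W → IsOpen W × ∃ (_∈ W) ×
      (∀ y → y ∈ W → r ≤ Tₓ z y) × (∀ k → ¬ z at inj₂ k ≈ 0# → ∀ y → y ∈ W → y ∉ ∂ K (V k))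

    attained-0 : Attained 0#
    attained-0 = ZB.0ᴹ , (λ k → ≤-trans (≈⇒≤ ∣0∣) 0≤1) ,
      (λ _ → ⊤) , open-whole (λ _ → tt) , (point , tt) ,
      (λ y _ → ≈⇒≤ (sym (T-kernel ZB.0ᴹ (λ k → refl) y))) ,
      λ k 0≉0 → ⊥-elim (0≉0 refl)

    module _ (k : Index) where

      -- The bump for the empty list serves as an element with coefficients `unit k`.
      u : Z.Elem
      u = proj₁ (bumps []) k

      u-unit : ∀ j → u at inj₂ j ≈ unit k j
      u-unit = proj₁ (proj₂ (bumps [])) k

      Tu-unit : ∀ j → T u at inj₂ j ≈ unit k j
      Tu-unit j = trans (+-cong (u-unit j) -0#≈0#) (+-identityʳ _)

    attained-step : ∀ {r} → Attained r → Attained (r + ¼)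
    attained-step {r} (z , z≤1 , W , W-open , (x₀ , x₀∈W) , r≤Tz , avoids) =
      let k , x , x∈W , x∈∂ = ∂-dense W W-open x₀ x₀∈W in
      add k x x∈W x∈∂
        (large-near-∂ k (regular k) (proj₁ (T (u k))) (proj₂ (proj₂ (proj₂ (T (u k)))))
          (Tu-unit k) W-open x∈W x∈∂)
      where
      module _ (k : Index) (σ : Carrier) where

        z+σu : Z.Elem
        z+σu = z ZB.+ᴹ (σ ZB.*ₗ u k)

        at-k : ∣ σ ∣ ≤ 1# → z at inj₂ k ≈ 0# → ∀ j → Dec (k ≈ᵢ j) → ∣ z+σu at inj₂ j ∣ ≤ 1#
        at-k σ≤1 z≈0 j (yes k≈j) = ≤-trans (≈⇒≤ (∣∣-cong (trans
          (+-cong (trans (cong (proj₁ z) (Pointwise.inj₂ (κ.sym k≈j))) z≈0)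
            (trans (*-congˡ (trans (u-unit k j) (unit-at k≈j))) (*-identityʳ σ)))
          (+-identityˡ σ)))) σ≤1
        at-k σ≤1 z≈0 j (no k≉j) = ≤-trans (≈⇒≤ (∣∣-cong (trans
          (+-congˡ (trans (*-congˡ (trans (u-unit k j) (unit-off k≉j))) (zeroʳ σ)))
          (+-identityʳ (z at inj₂ j))))) (z≤1 j)

        T-large : ∀ y → r ≤ Tₓ z y → ¼ ≤ σ * Tₓ (u k) y → r + ¼ ≤ Tₓ z+σu y
        T-large y p q = ≤-trans (+-mono-≤ p q)
          (≈⇒≤ (sym (trans (T-+ z (σ ZB.*ₗ u k) y) (+-congˡ (T-* σ (u k) y)))))

        vanishes : ∀ y → y ∈ W → y ∉ ∂ K (V k) → ∀ j → y ∈ ∂ K (V j) → z+σu at inj₂ j ≈ 0#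
        vanishes y y∈W y∉∂k j y∈∂j = trans
          (+-cong (decidable-stable em λ z≉0 → avoids j z≉0 y y∈W y∈∂j)
            (trans (*-congˡ (trans (u-unit k j) (unit-off λ k≈j →
              y∉∂k (∂-resp-≐ (V-cong (κ.sym k≈j) , V-cong k≈j) y∈∂j))))
              (zeroʳ σ)))
          (+-identityˡ 0#)

      add : ∀ k x → x ∈ W → x ∈ ∂ K (V k) →
        LargeIn k (regular k) (proj₁ (T (u k))) (proj₂ (proj₂ (proj₂ (T (u k))))) (Tu-unit k) W →
        Attained (r + ¼)
      add k x x∈W x∈∂ (σ , σ≤1 , W′ , W′-open , inhabited , W′⊆W , large , avoids-k) =
        z+σu k σ ,
        -- The point `x` of `W` lies on the boundary of `V k`, so `avoids` makes the coefficient of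
        -- `z` at `k` zero, and adding `σ` keeps it within 1.
        (λ j → at-k k σ σ≤1 (decidable-stable em λ z≉0 → avoids k z≉0 x x∈W x∈∂) j em) ,
        W′ , W′-open , inhabited ,
        (λ y y∈W′ → T-large k σ y (r≤Tz y (W′⊆W y∈W′)) (large y y∈W′)) ,
        λ j z≉0 y y∈W′ y∈∂ → z≉0 (vanishes k σ y (W′⊆W y∈W′) (avoids-k y y∈W′) j y∈∂)

    -- Attained values are bounded above by `T-bounded` but closed under adding ¼, so with `s` their
    -- supremum, `s - ¼` would be an upper bound too.
    no-retraction : ⊥
    no-retraction = <⇒≱ 0<¼ (+-cancelʳ-≤ s (≤-resp (+-comm s ¼) (sym (+-identityˡ s))
      (≤-resp refl (x-y+y s ¼) (+-monoˡ-≤ ¼ s≤s-¼))))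
      where
      supAttained : ∃ (IsSupremum Attained)
      supAttained = sup Attained (0# , attained-0) (proj₁ T-bounded ,
        λ r (z , z≤1 , _ , _ , (y , y∈W) , r≤ , _) →
          ≤-trans (r≤ y y∈W) (proj₂ T-bounded z z≤1 y))
      s : Carrier
      s = proj₁ supAttained
      s≤s-¼ : s ≤ s + - ¼
      s≤s-¼ = proj₂ (proj₂ supAttained) (s + - ¼) λ r r∈ → ≤-resp (x+y-y r ¼) refl
        (+-monoˡ-≤ (- ¼) (proj₁ (proj₂ supAttained) (r + ¼) (attained-step r∈)))

-- Indexing a regular tunnel by its cardinal.

theorem3p6 :
    (em : ∀ {a} → ExcludedMiddle a) (ℝ : CompleteOrderedField)
    {ℓ u i e : Level} (K : TopologicalSpace ℓ) →
    Nonempty K → (compact : Compact K) → Hausdorff K →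
    (κ : Setoid i e) (𝒰 : Pred (Pred (TopologicalSpace.Point K) ℓ) u) →
    IsRegularTunnel K 𝒰 → HasCardinality K 𝒰 κ →
    ∃ λ (Z : BanachSpace ℝ (suc ℓ ⊔ i ⊔ e) (ℓ ⊔ i)) →
    ∃ λ (S : ShortExactSequence ℝ (SupNorm.C em ℝ K compact) Z (SupNorm.c₀ em ℝ κ)) →
      ShortExactSequence.Nontrivial S
theorem3p6 em ℝ {ℓ} K point compact hausdorff κ 𝒰 tunnel card =
  Z , record
    { ι       = ι
    ; π       = π
    ; exact-Y = kernel-ι
    ; exact-Z = kernel-π
    ; exact-X = (λ {c} _ → π-surjective c) , λ _ → _
    } ,
  λ (ϖ , retraction) → Nontriviality.no-retraction point ∂-dense V-regular ϖ retraction
  where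
  open TopologicalSpace K using (Point; IsOpen)
  open Topology em K using (∂-resp-≐)
  open IsRegularTunnel tunnel
  open IsTunnel isTunnel
  open IsChain isChain
  open Setoid κ using () renaming (Carrier to Index; _≈_ to _≈ᵢ_)
  module card = Bijection card

  V : Index → Pred Point ℓ
  V k = proj₁ (card.to k)

  V-open : ∀ k → IsOpen (V k)
  V-open k = isOpen (proj₂ (card.to k))

  V-cong : ∀ {j k} → j ≈ᵢ k → V j ⊆ V k
  V-cong j≈k = proj₁ (card.cong j≈k)

  V-regular : ∀ k → interior K (closure K (V k)) ⊆ V k
  V-regular k = proj₂ (regular (proj₂ (card.to k)))

  comparable : ∀ j k → j ≈ᵢ k ⊎ _⋖_ K (V j) (V k) ⊎ _⋖_ K (V k) (V j)
  comparable j k with IsTotalOrder.total linearlyOrdered (card.to j) (card.to k)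
  ... | inj₁ (inj₁ Vj⋖Vk)      = inj₂ (inj₁ Vj⋖Vk)
  ... | inj₁ (inj₂ Vj≐Vk)      = inj₁ (card.injective Vj≐Vk)
  ... | inj₂ (inj₁ Vk⋖Vj)      = inj₂ (inj₂ Vk⋖Vj)
  ... | inj₂ (inj₂ (V⊆ , ⊆V))  = inj₁ (card.injective (⊆V , V⊆))

  -- Surjectivity of the indexing recovers a member only up to `≐`, which boundaries respect.
  ∂-dense : ∀ W → IsOpen W → ∀ x → x ∈ W → ∃ λ k → ∃ λ y → y ∈ W × y ∈ ∂ K (V k)
  ∂-dense W W-open x x∈W =
    let y , y∈W , (V′ , V′∈𝒰) , y∈∂ = dense x W W-open x∈W
        k , to-k = card.surjective (V′ , V′∈𝒰)
        V⊆V′ , V′⊆V = to-k (Setoid.refl κ)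
    in k , y , y∈W , ∂-resp-≐ (V′⊆V , V⊆V′) y∈∂

  open JumpSpace em ℝ K compact κ V
  open ChainLifting em ℝ K compact hausdorff κ V V-open V-cong comparable
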